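{- For all integers $k_1,l_1,k_2,l_2\ge0$ there is a bijection between $\mathcal{M}(k_1,l_1,k_2,l_2)$ and the set of pairs $(P,Q)$ such that $P$ is a hook composition tableau with letters from $\{1,\dots,k_1\}\cup\{1',\dots,l_1'\}$, $Q$ is a hook composition tableau with letters from $\{1,\dots,k_2\}\cup\{1',\dots,l_2'\}$, and the shapes of $P$ and $Q$ rearrange to the same partition. The bijection is weight preserving: if $M\mapsto(P,Q)$, then for each column label $c$ the number of entries $c$ in $P$ equals the sum of the entries of column $c$ of $M$, and for each row label $r$ the number of entries $r$ in $Q$ equals the sum of the entries of row $r$ of $M$.
   Context: $\mathcal{M}(k_1,l_1,k_2,l_2)$ is the set of $(k_2+l_2)\times(k_1+l_1)$ matrices $M$ whose rows are labeled $1,\dots,k_2,1',\dots,l_2'$ (top to bottom) and whose columns are labeled $1,\dots,k_1,1',\dots,l_1'$ (left to right), such that the entries in the block of unprimed rows and unprimed columns ($k_2\times k_1$) and in the block of primed rows and primed columns ($l_2\times l_1$) are nonnegative integers, while the entries in the block of unprimed rows and primed columns ($k_2\times l_1$) and the block of primed rows and unprimed columns ($l_2\times k_1$) are $0$ or $1$. For an alphabet $\mathcal{A}=\{1,\dots,k\}$, $\mathcal{A}'=\{1',\dots,l'\}$ ordered $1<\dots<k<1'<\dots<l'$, a hook composition tableau (HCT) of composition shape $\alpha=(\alpha_1,\dots,\alpha_r)$ (largest part $m$; French notation, $\alpha_i$ cells in row $i$ from the bottom, cell $(i,j)$ in row $i$, column $j$) is a filling $F$ with letters of $\mathcal{A}\cup\mathcal{A}'$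 such that rows weakly increase left to right; unprimed entries weakly and primed strictly increase along rows; in the leftmost column unprimed entries strictly and primed weakly increase bottom to top; and with $\hat F$ the $r\times m$ array with $\infty$ (larger than all letters, in neither alphabet) in missing cells, for $1\le i<j\le r$, $1\le n<m$: (a) if $\hat F(i,n+1)\in\mathcal{A}$ and $\hat F(i,n+1)\ge\hat F(j,n)$ then $\hat F(i,n+1)>\hat F(j,n+1)$; (b) if $\hat F(i,n+1)\in\mathcal{A}'$ and $\hat F(i,n+1)>\hat F(j,n)$ then $\hat F(i,n+1)\ge\hat F(j,n+1)$. The shape of $F$ rearranges to a partition $\lambda$ if sorting the parts of $\alpha$ into weakly decreasing order gives $\lambda$. -}

module Defs where

open import Data.Nat using (ℕ; zero; suc; _+_; _<_; _≤_; _⊔_; _≤ᵇ_)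
open import Data.Fin as Fin using (Fin; join)
open import Data.Sum using (_⊎_; inj₁; inj₂)
open import Data.Sum.Properties using (≡-dec)
open import Data.Fin.Properties using (_≟_)
open import Data.Product using (Σ; _×_; _,_; proj₁; proj₂)
open import Data.Maybe using (Maybe; just; nothing)
open import Data.List using (List; []; _∷_; length; map; foldr)
open import Data.Nat.ListAction using (sum)
open import Data.List.Relation.Unary.All using (All)
open import Data.Vec using (Vec; lookup; toList)
open import Data.Bool using (if_then_else_)
open import Relation.Nullary using (yes; no)
open import Relation.Binary.PropositionalEquality using (_≡_; refl; isEquivalence)
open import Relation.Binary.Bundles using (Setoid)
import Relation.Binary.Construct.On as On
open import Level using (0ℓ)

-- Alphabet A ∪ A' = {1..k} ∪ {1'..l'}, ordered 1<…<k<1'<…<l'.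
-- inj₁ i is the unprimed letter i+1, inj₂ j the primed letter (j+1)'.

Letter : ℕ → ℕ → Set
Letter k l = Fin k ⊎ Fin l

data _<ᴸ_ {k l : ℕ} : Letter k l → Letter k l → Set where
  u<u : ∀ {i j} → i Fin.< j → inj₁ i <ᴸ inj₁ j
  u<p : ∀ {i j} → inj₁ i <ᴸ inj₂ j
  p<p : ∀ {i j} → i Fin.< j → inj₂ i <ᴸ inj₂ j

-- extended letters: nothing = ∞ (larger than every letter, in neither alphabet)
Ext : ℕ → ℕ → Set
Ext k l = Maybe (Letter k l)

data _<ᴱ_ {k l : ℕ} : Ext k l → Ext k l → Set where
  fin : ∀ {x y} → x <ᴸ y → just x <ᴱ just y
  inf : ∀ {x} → just x <ᴱ nothing

_≤ᴱ_ : ∀ {k l} → Ext k l → Ext k l → Set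
x ≤ᴱ y = x <ᴱ y ⊎ x ≡ y

data Unprimed {k l : ℕ} : Ext k l → Set where
  unp : ∀ {i} → Unprimed (just (inj₁ i))

data Primed {k l : ℕ} : Ext k l → Set where
  pr : ∀ {j} → Primed (just (inj₂ j))

-- Fillings: a list of rows, head = bottom row (row 1), each row listed
-- left to right.  The shape (a composition) is the list of row lengths.

Filling : ℕ → ℕ → Set
Filling k l = List (List (Letter k l))

shape : ∀ {k l} → Filling k l → List ℕ
shape F = map length F

nth : ∀ {A : Set} → List A → ℕ → Maybe A
nth []       _       = nothing
nth (x ∷ xs) zero    = just x
nth (x ∷ xs) (suc n) = nth xs n

-- F̂(i,n) with 0-based indices; nothing (= ∞) for missing cells
cell : ∀ {k l} → Filling k l → ℕ → ℕ → Ext k l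
cell []       _       _ = nothing
cell (r ∷ F)  zero    n = nth r n
cell (r ∷ F)  (suc i) n = cell F i n

maxPart : List ℕ → ℕ
maxPart = foldr _⊔_ 0

record IsHCT {k l : ℕ} (F : Filling k l) : Set where
  field
    composition : All (λ row → 0 < length row) F
    rows : ∀ i n x y → cell F i n ≡ just x → cell F i (suc n) ≡ just y →
           x <ᴸ y ⊎ (x ≡ y × Unprimed (just x))
    firstColumn : ∀ i x y → cell F i 0 ≡ just x → cell F (suc i) 0 ≡ just y →
                  x <ᴸ y ⊎ (x ≡ y × Primed (just x))
    tripleA : ∀ i j n → i < j → j < length F → suc n < maxPart (shape F) →
              Unprimed (cell F i (suc n)) →
              cell F j n ≤ᴱ cell F i (suc n) →
              cell F j (suc n) <ᴱ cell F i (suc n)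
    tripleB : ∀ i j n → i < j → j < length F → suc n < maxPart (shape F) →
              Primed (cell F i (suc n)) →
              cell F j n <ᴱ cell F i (suc n) →
              cell F j (suc n) ≤ᴱ cell F i (suc n)

insertDesc : ℕ → List ℕ → List ℕ
insertDesc x [] = x ∷ []
insertDesc x (y ∷ ys) = if y ≤ᵇ x then x ∷ y ∷ ys else y ∷ insertDesc x ys

sortDesc : List ℕ → List ℕ
sortDesc = foldr insertDesc []

countRow : ∀ {k l} → Letter k l → List (Letter k l) → ℕ
countRow c [] = 0
countRow c (x ∷ xs) with ≡-dec _≟_ _≟_ x c
... | yes _ = suc (countRow c xs)
... | no  _ = countRow c xs

count : ∀ {k l} → Letter k l → Filling k l → ℕ
count c F = sum (map (countRow c) F)

-- Matrices: rows labelled by Letter k₂ l₂ (1..k₂,1'..l₂' top to bottom),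
-- columns by Letter k₁ l₁.

Matrix : ℕ → ℕ → ℕ → ℕ → Set
Matrix k₁ l₁ k₂ l₂ = Vec (Vec ℕ (k₁ + l₁)) (k₂ + l₂)

entry : ∀ {k₁ l₁ k₂ l₂} → Matrix k₁ l₁ k₂ l₂ → Letter k₂ l₂ → Letter k₁ l₁ → ℕ
entry {k₁} {l₁} {k₂} {l₂} M r c = lookup (lookup M (join k₂ l₂ r)) (join k₁ l₁ c)

data Mixed {k₁ l₁ k₂ l₂ : ℕ} : Letter k₂ l₂ → Letter k₁ l₁ → Set where
  up : ∀ {i j} → Mixed (inj₁ i) (inj₂ j)
  pu : ∀ {i j} → Mixed (inj₂ i) (inj₁ j)

InM : ∀ k₁ l₁ k₂ l₂ → Matrix k₁ l₁ k₂ l₂ → Set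
InM k₁ l₁ k₂ l₂ M = ∀ r c → Mixed {k₁} {l₁} {k₂} {l₂} r c → entry {k₁} {l₁} {k₂} {l₂} M r c ≤ 1

rowSum : ∀ k₁ l₁ k₂ l₂ → Matrix k₁ l₁ k₂ l₂ → Letter k₂ l₂ → ℕ
rowSum k₁ l₁ k₂ l₂ M r = sum (toList (lookup M (join k₂ l₂ r)))

colSum : ∀ k₁ l₁ k₂ l₂ → Matrix k₁ l₁ k₂ l₂ → Letter k₁ l₁ → ℕ
colSum k₁ l₁ k₂ l₂ M c = sum (toList (Data.Vec.map (λ row → lookup row (join k₁ l₁ c)) M))

-- The two sets, as setoids whose equality is equality of the underlying
-- data (matrix, resp. pair of fillings); proofs of membership are ignored.

subSetoid : (A : Set) (P : A → Set) → Setoid 0ℓ 0ℓ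
subSetoid A P = record
  { Carrier = Σ A P
  ; _≈_ = λ x y → proj₁ x ≡ proj₁ y
  ; isEquivalence = On.isEquivalence proj₁ isEquivalence }

𝓜 : ℕ → ℕ → ℕ → ℕ → Setoid 0ℓ 0ℓ
𝓜 k₁ l₁ k₂ l₂ = subSetoid (Matrix k₁ l₁ k₂ l₂) (InM k₁ l₁ k₂ l₂)

IsHCTPair : ∀ {k₁ l₁ k₂ l₂} → Filling k₁ l₁ × Filling k₂ l₂ → Set
IsHCTPair (P , Q) = IsHCT P × IsHCT Q × sortDesc (shape P) ≡ sortDesc (shape Q)

HCTPairs : ℕ → ℕ → ℕ → ℕ → Setoid 0ℓ 0ℓ
HCTPairs k₁ l₁ k₂ l₂ = subSetoid (Filling k₁ l₁ × Filling k₂ l₂) IsHCTPair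

{-# OPTIONS --safe #-}
-- A hook composition tableau is a chain of compositions, one for each letter. A new largest letter adds cells to a
-- composition β, and among the admissible ways to do so there is exactly one for each horizontal strip (unprimed
-- letter) or vertical strip (primed letter) over the partition obtained by sorting β: in every column the topmost
-- rows of the right length are extended. Sorting therefore turns tableaux into chains of partitions. Pairs of chains
-- with a common end are in bijection with matrices by growth diagrams: for partitions μ, ν two strips fill the unit
-- square with corners λ, μ, ν, ρ, and a local rule exchanges λ together with a matrix entry for ρ, preserving sizes.
module Submission where

open import Defs
open import Data.Nat
open import Data.Nat.Properties
open import Data.Nat.ListAction using (sum)
open import Data.Nat.Tactic.RingSolver using (solve-∀)
open import Data.Bool using (true; false; T)
open import Data.Empty using (⊥; ⊥-elim)
open import Data.Unit using (⊤; tt)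
open import Data.Fin as Fin using (Fin; opposite; splitAt; join)
import Data.Fin.Properties as Fin
import Data.Fin.Permutation as Perm
open import Data.Maybe using (just; nothing)
open import Data.Maybe.Properties using (just-injective)
open import Data.Product using (Σ; _×_; _,_; proj₁; proj₂; ∃)
open import Data.Sum as Sum using (_⊎_; inj₁; inj₂; [_,_]′)
open import Data.Sum.Properties using (≡-dec)
open import Data.List using (List; []; _∷_; length; replicate; _++_)
open import Data.List.Properties using (length-++; length-replicate)
open import Data.List.Relation.Unary.All using (All; []; _∷_)
open import Data.List.Relation.Unary.All.Properties using (map⁺; map⁻)
open import Data.Vec as Vec using (Vec; []; _∷_; lookup; tabulate)
open import Data.Vec.Properties using
  (lookup∘tabulate; tabulate∘lookup; tabulate-cong; lookup-map; lookup-replicate; lookup-zipWith)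
import Algebra.Properties.CommutativeMonoid.Sum +-0-commutativeMonoid as Sumᶠ
open import Function using (_∘_)
open import Function.Bundles using (Inverse)
open import Relation.Nullary using (¬_; yes; no)
open import Relation.Binary using (tri<; tri≈; tri>)
open import Relation.Binary.PropositionalEquality

-- Partitions and their column heights

-- Column heights forget exactly the order of the parts, so `heights` stands in for sorting
-- throughout. Conditions (a) and (b) forbid a new cell below a row that ends just before its column
-- and was free to take it. This makes the extension by a given strip unique; its existence depends
-- on the order of filling. A horizontal strip is filled from left to right, since a row may grow
-- repeatedly and a column needs the final height of the one before it. A vertical strip is filled
-- from right to left, so that a row just lengthened is not lengthened again. Only two local rules
-- need proof: conjugation turns two horizontal strips into two vertical ones, and reflecting the
-- square exchanges the two mixed cases. In a mixed square the entry is one bit, pushed from left to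
-- right going forward and recovered from right to left going back. Each rule satisfies |ρ| + |λ| =
-- |μ| + |ν| + m, from which both weight statements follow. The bijection comes from a relation with
-- existence and uniqueness in both directions, so the two constructions never have to be composed.

at : List ℕ → ℕ → ℕ
at []      _       = 0
at (x ∷ p) zero    = x
at (x ∷ p) (suc n) = at p n

tl : List ℕ → List ℕ
tl []      = []
tl (x ∷ p) = p

at-tl : ∀ p n → at (tl p) n ≡ at p (suc n)
at-tl []      n = refl
at-tl (x ∷ p) n = refl

at-beyond : ∀ p {n} → length p ≤ n → at p n ≡ 0
at-beyond []      _         = refl
at-beyond (x ∷ p) (s≤s len) = at-beyond p len

Pos : List ℕ → Set
Pos = All (0 <_)

Dec : List ℕ → Set
Dec p = ∀ n → at p (suc n) ≤ at p n

Part : List ℕ → Set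
Part p = Pos p × Dec p

-- `at` cannot see trailing zeros; positivity excludes them.
at-ext : ∀ {p q} → Pos p → Pos q → (∀ n → at p n ≡ at q n) → p ≡ q
at-ext []       []       e = refl
at-ext []       (y ∷ pq) e = ⊥-elim (<⇒≢ y (e 0))
at-ext (x ∷ pp) []       e = ⊥-elim (<⇒≢ x (sym (e 0)))
at-ext (x ∷ pp) (y ∷ pq) e = cong₂ _∷_ (e 0) (at-ext pp pq (e ∘ suc))

pos-down : ∀ {p} → Pos p → ∀ i j → i ≤ j → 0 < at p j → 0 < at p i
pos-down (x ∷ pp) zero    j       le       h = x
pos-down (x ∷ pp) (suc i) (suc j) (s≤s le) h = pos-down pp i j le h

dec-≤ : ∀ {p} → Dec p → ∀ {i j} → i ≤ j → at p j ≤ at p i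
dec-≤ {p} d {i} {j} le with ≤⇒≤′ le
... | ≤′-refl     = ≤-refl
... | ≤′-step le′ = ≤-trans (d _) (dec-≤ {p} d (≤′⇒≤ le′))

-- Stops at the first zero of f, so it lists all nonzero values only if f is weakly decreasing.
fromFun : ℕ → (ℕ → ℕ) → List ℕ
fromFun zero    f = []
fromFun (suc N) f with f 0
... | zero  = []
... | suc x = suc x ∷ fromFun N (f ∘ suc)

fromFun-pos : ∀ N f → Pos (fromFun N f)
fromFun-pos zero    f = []
fromFun-pos (suc N) f with f 0
... | zero  = []
... | suc x = s≤s z≤n ∷ fromFun-pos N (f ∘ suc)

antitone-zero : ∀ (f : ℕ → ℕ) → (∀ n → f (suc n) ≤ f n) → f 0 ≡ 0 → ∀ n → f n ≡ 0
antitone-zero f d z zero    = z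
antitone-zero f d z (suc n) = n≤0⇒n≡0 (≤-trans (d n) (≤-reflexive (antitone-zero f d z n)))

at-fromFun : ∀ N f → (∀ n → f (suc n) ≤ f n) → (∀ n → N ≤ n → f n ≡ 0) →
             ∀ n → at (fromFun N f) n ≡ f n
at-fromFun zero    f d z n = sym (z n z≤n)
at-fromFun (suc N) f d z n with f 0 in eq
... | zero = sym (antitone-zero f d eq n)
at-fromFun (suc N) f d z zero    | suc x = sym eq
at-fromFun (suc N) f d z (suc n) | suc x =
  at-fromFun N (f ∘ suc) (d ∘ suc) (λ m le → z (suc m) (s≤s le)) n

sumTo : ℕ → (ℕ → ℕ) → ℕ
sumTo zero    f = 0
sumTo (suc N) f = sumTo N f + f N

sumTo-head : ∀ N f → sumTo (suc N) f ≡ f 0 + sumTo N (f ∘ suc)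
sumTo-head zero    f = sym (+-identityʳ (f 0))
sumTo-head (suc N) f = trans (cong (_+ f (suc N)) (sumTo-head N f)) (+-assoc (f 0) _ _)

sumTo-zero : ∀ N f → (∀ n → f n ≡ 0) → sumTo N f ≡ 0
sumTo-zero zero    f z = refl
sumTo-zero (suc N) f z rewrite sumTo-zero N f z = z N

sumTo-at : ∀ p N → length p ≤ N → sumTo N (at p) ≡ sum p
sumTo-at []      N       le       = sumTo-zero N _ (λ _ → refl)
sumTo-at (x ∷ p) (suc N) (s≤s le) = trans (sumTo-head N (at (x ∷ p))) (cong (x +_) (sumTo-at p N le))

ind : ℕ → ℕ → ℕ
ind n       zero    = 0
ind zero    (suc a) = 1
ind (suc n) (suc a) = ind n a

ind-< : ∀ {n a} → n < a → ind n a ≡ 1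
ind-< {zero}  {suc a} h       = refl
ind-< {suc n} {suc a} (s≤s h) = ind-< h

ind-≥ : ∀ {n a} → a ≤ n → ind n a ≡ 0
ind-≥ {n}     {zero}  h       = refl
ind-≥ {suc n} {suc a} (s≤s h) = ind-≥ h

ind-≤1 : ∀ n a → ind n a ≤ 1
ind-≤1 n       zero    = z≤n
ind-≤1 zero    (suc a) = ≤-refl
ind-≤1 (suc n) (suc a) = ind-≤1 n a

ind-mono : ∀ n m a b → (n < a → m < b) → ind n a ≤ ind m b
ind-mono n m a b h with n <? a
... | yes p = ≤-trans (ind-≤1 n a) (≤-reflexive (sym (ind-< (h p))))
... | no np = ≤-trans (≤-reflexive (ind-≥ (≮⇒≥ np))) z≤n

cnt : ℕ → List ℕ → ℕ
cnt n []      = 0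
cnt n (a ∷ α) = ind n a + cnt n α

cnt-tl : ∀ n α → cnt n α ≡ ind n (at α 0) + cnt n (tl α)
cnt-tl n []      = refl
cnt-tl n (a ∷ α) = refl

bump : ℕ → List ℕ → List ℕ
bump zero    h       = h
bump (suc a) []      = 1 ∷ bump a []
bump (suc a) (x ∷ h) = suc x ∷ bump a h

-- Column heights of a composition; on partitions this is conjugation.
heights : List ℕ → List ℕ
heights []      = []
heights (a ∷ α) = bump a (heights α)

at-bump : ∀ a h n → at (bump a h) n ≡ ind n a + at h n
at-bump zero    h       n       = refl
at-bump (suc a) []      zero    = refl
at-bump (suc a) []      (suc n) = at-bump a [] n
at-bump (suc a) (x ∷ h) zero    = refl
at-bump (suc a) (x ∷ h) (suc n) = at-bump a h n

at-heights : ∀ α n → at (heights α) n ≡ cnt n α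
at-heights []      n = refl
at-heights (a ∷ α) n = trans (at-bump a (heights α) n) (cong (ind n a +_) (at-heights α n))

bump-pos : ∀ a {h} → Pos h → Pos (bump a h)
bump-pos zero    ph       = ph
bump-pos (suc a) []       = s≤s z≤n ∷ bump-pos a []
bump-pos (suc a) (x ∷ ph) = s≤s z≤n ∷ bump-pos a ph

heights-pos : ∀ α → Pos (heights α)
heights-pos []      = []
heights-pos (a ∷ α) = bump-pos a (heights-pos α)

sum-bump : ∀ a h → sum (bump a h) ≡ a + sum h
sum-bump zero    h       = refl
sum-bump (suc a) []      = cong suc (sum-bump a [])
sum-bump (suc a) (x ∷ h) = cong suc (trans (cong (x +_) (sum-bump a h)) (lem x a (sum h)))
  where
  lem : ∀ x a s → x + (a + s) ≡ a + (x + s)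
  lem = solve-∀

sum-heights : ∀ α → sum (heights α) ≡ sum α
sum-heights []      = refl
sum-heights (a ∷ α) = trans (sum-bump a (heights α)) (cong (a +_) (sum-heights α))

-- Rows are compared one by one. The two thresholds may differ, so that interlacing between
-- neighbouring columns is covered as well.
cnt-mono : ∀ {n m} α β → (∀ i → n < at α i → m < at β i) → cnt n α ≤ cnt m β
cnt-mono         []      β h = z≤n
cnt-mono {n} {m} (a ∷ α) β h rewrite cnt-tl m β =
  +-mono-≤ (ind-mono n m a (at β 0) (h 0))
           (cnt-mono α (tl β) (λ i q → subst (m <_) (sym (at-tl β i)) (h (suc i) q)))

heights-dec : ∀ α → Dec (heights α)
heights-dec α n rewrite at-heights α n | at-heights α (suc n) =
  cnt-mono α α (λ i q → <-trans (n<1+n n) q)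

heights-part : ∀ α → Part (heights α)
heights-part α = heights-pos α , heights-dec α

cnt-zero : ∀ n α → (∀ i → at α i ≤ n) → cnt n α ≡ 0
cnt-zero n α h = n≤0⇒n≡0 (cnt-mono {n} {0} α [] (λ i q → ⊥-elim (<⇒≱ q (h i))))

-- With `galois-from`: both sides say that row `i` and column `n` meet in a cell of the diagram.
-- Because `p` decreases, the rows longer than `n` are the first `cnt n p` ones.
galois-to : ∀ {p n i} → Dec p → n < at p i → i < cnt n p
galois-to {a ∷ p} {n} {zero} d h rewrite ind-< h = s≤s z≤n
galois-to {a ∷ p} {n} {suc i} d h
  rewrite ind-< {n} {a} (<-≤-trans h (dec-≤ {a ∷ p} d {0} {suc i} z≤n)) =
  s≤s (galois-to {p} (d ∘ suc) h)

galois-from : ∀ {p n i} → Dec p → i < cnt n p → n < at p i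
galois-from {a ∷ p} {n} {i} d h with n <? a
galois-from {a ∷ p} {n} {zero}  d h | yes q = q
galois-from {a ∷ p} {n} {suc i} d h | yes q rewrite ind-< q = galois-from {p} (d ∘ suc) (≤-pred h)
... | no nq = ⊥-elim (<⇒≢ (≤-<-trans z≤n h) (sym (cnt-zero n (a ∷ p)
                (λ j → ≤-trans (dec-≤ {a ∷ p} d {0} {j} z≤n) (≮⇒≥ nq)))))

<-ext : ∀ {a b} → (∀ n → n < a → n < b) → (∀ n → n < b → n < a) → a ≡ b
<-ext {a} {b} f g = ≤-antisym (le f) (le g)
  where
  le : ∀ {a b} → (∀ n → n < a → n < b) → a ≤ b
  le {zero}  f = z≤n
  le {suc a} f = f a ≤-refl

heights-inj : ∀ {p q} → Part p → Part q → heights p ≡ heights q → p ≡ q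
heights-inj {p} {q} (pp , dp) (pq , dq) e =
  at-ext pp pq (λ i → <-ext (λ n → step {p} {q} dp dq e n i) (λ n → step {q} {p} dq dp (sym e) n i))
  where
  step : ∀ {p q} → Dec p → Dec q → heights p ≡ heights q → ∀ n i → n < at p i → n < at q i
  step {p} {q} dp dq e n i h = galois-from {q} dq
    (subst (i <_) (trans (sym (at-heights p n)) (trans (cong (λ r → at r n) e) (at-heights q n)))
      (galois-to {p} dp h))

-- The relation between rows and columns is used twice, for `p` and for its conjugate.
heights-involutive : ∀ {p} → Part p → heights (heights p) ≡ p
heights-involutive {p} (pp , dp) = at-ext (heights-pos (heights p)) pp λ i → <-ext
  (λ n h → galois-from {p} dp (subst (i <_) (at-heights p n)
     (galois-from {heights p} (heights-dec p) (subst (n <_) (at-heights (heights p) i) h))))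
  (λ n h → subst (n <_) (sym (at-heights (heights p) i))
     (galois-to {heights p} (heights-dec p) (subst (i <_) (sym (at-heights p n)) (galois-to {p} dp h))))

bump-comm : ∀ a b h → bump a (bump b h) ≡ bump b (bump a h)
bump-comm zero    b       h       = refl
bump-comm (suc a) zero    h       = refl
bump-comm (suc a) (suc b) []      = cong (2 ∷_) (bump-comm a b [])
bump-comm (suc a) (suc b) (x ∷ h) = cong (suc (suc x) ∷_) (bump-comm a b h)

heights-insertDesc : ∀ a α → heights (insertDesc a α) ≡ bump a (heights α)
heights-insertDesc a []      = refl
heights-insertDesc a (b ∷ α) with b ≤ᵇ a
... | true  = refl
... | false = trans (cong (bump b) (heights-insertDesc a α)) (bump-comm b a (heights α))

-- Sorting only permutes the `bump`s, and these commute.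
heights-sortDesc : ∀ α → heights (sortDesc α) ≡ heights α
heights-sortDesc []      = refl
heights-sortDesc (a ∷ α) = trans (heights-insertDesc a (sortDesc α)) (cong (bump a) (heights-sortDesc α))

insertDesc-pos : ∀ {a α} → 0 < a → Pos α → Pos (insertDesc a α)
insertDesc-pos         pa []       = pa ∷ []
insertDesc-pos {a} {b ∷ α} pa (pb ∷ pα) with b ≤ᵇ a
... | true  = pa ∷ pb ∷ pα
... | false = pb ∷ insertDesc-pos pa pα

at-insertDesc : ∀ a α {n} → at α 0 ≤ n → a ≤ n → at (insertDesc a α) 0 ≤ n
at-insertDesc a []      p q = q
at-insertDesc a (b ∷ α) p q with b ≤ᵇ a
... | true  = q
... | false = p

insertDesc-dec : ∀ a α → Dec α → Dec (insertDesc a α)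
insertDesc-dec a []      d n = z≤n
insertDesc-dec a (b ∷ α) d n with b ≤ᵇ a in eq
insertDesc-dec a (b ∷ α) d zero    | true  = ≤ᵇ⇒≤ b a (subst T (sym eq) _)
insertDesc-dec a (b ∷ α) d (suc n) | true  = d n
insertDesc-dec a (b ∷ α) d zero    | false =
  at-insertDesc a α (d 0) (≰⇒≥ (λ le → subst T eq (≤⇒≤ᵇ le)))
insertDesc-dec a (b ∷ α) d (suc n) | false = insertDesc-dec a α (d ∘ suc) n

sortDesc-part : ∀ {α} → Pos α → Part (sortDesc α)
sortDesc-part []       = [] , (λ _ → z≤n)
sortDesc-part {a ∷ α} (pa ∷ pα) with sortDesc-part pα
... | ps , ds = insertDesc-pos pa ps , insertDesc-dec a (sortDesc α) ds

-- A sorted shape is a partition, hence determined by its column heights. With `heights-≡` this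
-- replaces the condition that two shapes rearrange to the same partition by equality of `heights`.
sortDesc-≡ : ∀ {α β} → Pos α → Pos β → heights α ≡ heights β → sortDesc α ≡ sortDesc β
sortDesc-≡ {α} {β} pα pβ e = heights-inj (sortDesc-part pα) (sortDesc-part pβ)
  (trans (heights-sortDesc α) (trans e (sym (heights-sortDesc β))))

heights-≡ : ∀ {α β} → sortDesc α ≡ sortDesc β → heights α ≡ heights β
heights-≡ {α} {β} e = trans (sym (heights-sortDesc α)) (trans (cong heights e) (heights-sortDesc β))

-- Local rules

-- H marks unprimed letters and horizontal strips, V primed letters and vertical strips.
data Tag : Set where
  H V : Tag

-- Partitions are given by their column heights, which is why horizontal strips are the 0/1 increments.
Step : Tag → List ℕ → List ℕ → Set
Step H p q = ∀ n → at p n ≤ at q n × at q n ≤ suc (at p n)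
Step V p q = ∀ n → at p n ≤ at q n × at q (suc n) ≤ at p n

step-≤ : ∀ τ {p q} → Step τ p q → ∀ n → at p n ≤ at q n
step-≤ H s n = proj₁ (s n)
step-≤ V s n = proj₁ (s n)

step-[] : ∀ τ → Step τ [] []
step-[] H n = z≤n , z≤n
step-[] V n = z≤n , z≤n

step-into-[] : ∀ τ {p} → Part p → Step τ p [] → p ≡ []
step-into-[] τ (pp , _) s = at-ext pp [] (λ n → n≤0⇒n≡0 (step-≤ τ s n))

-- A row reaching beyond column `n + 1` in `q` is at most one cell shorter in `p` and so reaches
-- beyond `n` there; counting such rows gives the interlacing.
conj-H : ∀ {p q} → Step H p q → Step V (heights p) (heights q)
conj-H {p} {q} s n rewrite at-heights p n | at-heights q n | at-heights q (suc n) =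
  cnt-mono p q (λ i h → <-≤-trans h (proj₁ (s i))) ,
  cnt-mono q p (λ i h → ≤-pred (≤-trans h (proj₂ (s i))))

-- Without its first row `q` fits row by row into `p`, so each of its columns is at most one cell
-- taller.
conj-V : ∀ {p q} → Step V p q → Step H (heights p) (heights q)
conj-V {p} {q} s n rewrite at-heights p n | at-heights q n =
  cnt-mono p q (λ i h → <-≤-trans h (proj₁ (s i))) ,
  ≤-trans (≤-reflexive (cnt-tl n q))
    (+-mono-≤ (ind-≤1 n (at q 0))
      (cnt-mono (tl q) p (λ i h → <-≤-trans (subst (n <_) (at-tl q i) h) (proj₂ (s i)))))

-- In the local rules VV, HH, HV, the strips l → u and v → r are of the first type, l → v and u → r of the second,
-- and m is the matrix entry of the square. VV is the piecewise linear toggle of RSK, on column heights.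
VV : (l u v : List ℕ) → ℕ → List ℕ → Set
VV l u v m r =
  at r 0 ≡ at u 0 ⊔ at v 0 + m ×
  (∀ n → at r (suc n) + at l n ≡ (at u (suc n) ⊔ at v (suc n)) + (at u n ⊓ at v n))

module _ {l u v : List ℕ} (lu : Step V l u) (lv : Step V l v) where

  private
    max≤ : ∀ n → at u (suc n) ⊔ at v (suc n) ≤ at l n
    max≤ n = ⊔-lub (proj₂ (lu n)) (proj₂ (lv n))

    ≤min : ∀ n → at l n ≤ at u n ⊓ at v n
    ≤min n = ⊓-glb (proj₁ (lu n)) (proj₁ (lv n))

  -- Interlacing gives `max (n + 1) ≤ l n ≤ min n` for the entries of `u` and `v`. Hence the
  -- subtraction is exact, and `f` lies between the maximum in its own column and the minimum in the
  -- previous one, which is what both strip conditions ask.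
  vv-forward : ∀ m → Σ (List ℕ) λ r → Part r × Step V u r × Step V v r × VV l u v m r
  vv-forward m = r , (fromFun-pos N f , dec-r) , ur , vr , at-r 0 , rule
    where
    f : ℕ → ℕ
    f zero    = at u 0 ⊔ at v 0 + m
    f (suc n) = (at u (suc n) ⊔ at v (suc n)) + ((at u n ⊓ at v n) ∸ at l n)
    -- The successor allows for `r` having one entry more than `u`, as `f (suc n)` is bounded only
    -- by `at u n`.
    N = suc (length u + length v)
    max≤f : ∀ n → at u n ⊔ at v n ≤ f n
    max≤f zero    = m≤m+n _ m
    max≤f (suc n) = m≤m+n _ _
    f≤min : ∀ n → f (suc n) ≤ at u n ⊓ at v n
    f≤min n = ≤-trans (+-monoˡ-≤ _ (max≤ n)) (≤-reflexive (m+[n∸m]≡n (≤min n)))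
    f-dec : ∀ n → f (suc n) ≤ f n
    f-dec n = ≤-trans (f≤min n) (≤-trans (m⊓n≤m _ _) (≤-trans (m≤m⊔n _ _) (max≤f n)))
    f-zero : ∀ n → N ≤ n → f n ≡ 0
    f-zero (suc n) (s≤s le) = n≤0⇒n≡0 (≤-trans (f≤min n) (≤-trans (m⊓n≤m _ _)
      (≤-reflexive (at-beyond u (≤-trans (m≤m+n _ _) le)))))
    r = fromFun N f
    at-r : ∀ n → at r n ≡ f n
    at-r = at-fromFun N f f-dec f-zero
    dec-r : Dec r
    dec-r n rewrite at-r n | at-r (suc n) = f-dec n
    ur : Step V u r
    ur n rewrite at-r n | at-r (suc n) =
      ≤-trans (m≤m⊔n _ _) (max≤f n) , ≤-trans (f≤min n) (m⊓n≤m _ _)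
    vr : Step V v r
    vr n rewrite at-r n | at-r (suc n) =
      ≤-trans (m≤n⊔m _ _) (max≤f n) , ≤-trans (f≤min n) (m⊓n≤n _ _)
    rule : ∀ n → at r (suc n) + at l n ≡ (at u (suc n) ⊔ at v (suc n)) + (at u n ⊓ at v n)
    rule n rewrite at-r (suc n) =
      trans (+-assoc (at u (suc n) ⊔ at v (suc n)) _ (at l n)) (cong ((at u (suc n) ⊔ at v (suc n)) +_) (m∸n+n≡m (≤min n)))

-- The toggle is solved for `l` from the entries of `r` after the first; the excess of the first
-- entry over the maximum is the matrix entry.
vv-backward : ∀ {u v r} → Part u → Step V u r → Step V v r →
  Σ (List ℕ) λ l → Σ ℕ λ m → Part l × Step V l u × Step V l v × VV l u v m r
vv-backward {u} {v} {r} (_ , du) ur vr =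
  l , m , (fromFun-pos N f , dec-l) , lu , lv , sym (m+[n∸m]≡n (max≤ 0)) , rule
  where
  max≤ : ∀ n → at u n ⊔ at v n ≤ at r n
  max≤ n = ⊔-lub (proj₁ (ur n)) (proj₁ (vr n))
  ≤min : ∀ n → at r (suc n) ≤ at u n ⊓ at v n
  ≤min n = ⊓-glb (proj₂ (ur n)) (proj₂ (vr n))
  m = at r 0 ∸ (at u 0 ⊔ at v 0)
  f : ℕ → ℕ
  f n = (at u (suc n) ⊔ at v (suc n)) + ((at u n ⊓ at v n) ∸ at r (suc n))
  N = length u
  max≤f : ∀ n → at u (suc n) ⊔ at v (suc n) ≤ f n
  max≤f n = m≤m+n _ _
  f≤min : ∀ n → f n ≤ at u n ⊓ at v n
  f≤min n = ≤-trans (+-monoˡ-≤ _ (max≤ (suc n))) (≤-reflexive (m+[n∸m]≡n (≤min n)))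
  f-dec : ∀ n → f (suc n) ≤ f n
  f-dec n = ≤-trans (f≤min (suc n)) (≤-trans (m⊓n≤m _ _) (≤-trans (m≤m⊔n _ _) (max≤f n)))
  f-zero : ∀ n → N ≤ n → f n ≡ 0
  f-zero n le = n≤0⇒n≡0 (≤-trans (f≤min n) (≤-trans (m⊓n≤m _ _) (≤-reflexive (at-beyond u le))))
  l = fromFun N f
  at-l : ∀ n → at l n ≡ f n
  at-l = at-fromFun N f f-dec f-zero
  dec-l : Dec l
  dec-l n rewrite at-l n | at-l (suc n) = f-dec n
  lu : Step V l u
  lu n rewrite at-l n = ≤-trans (f≤min n) (m⊓n≤m _ _) , ≤-trans (m≤m⊔n _ _) (max≤f n)
  lv : Step V l v
  lv n rewrite at-l n = ≤-trans (f≤min n) (m⊓n≤n _ _) , ≤-trans (m≤n⊔m _ _) (max≤f n)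
  rule : ∀ n → at r (suc n) + at l n ≡ (at u (suc n) ⊔ at v (suc n)) + (at u n ⊓ at v n)
  rule n rewrite at-l n = trans (lem (at r (suc n)) (at u (suc n) ⊔ at v (suc n)) (at u n ⊓ at v n ∸ at r (suc n)))
    (cong ((at u (suc n) ⊔ at v (suc n)) +_) (m∸n+n≡m (≤min n)))
    where
    lem : ∀ a b c → a + (b + c) ≡ b + (c + a)
    lem = solve-∀

vv-forward-unique : ∀ {l u v m r r′} → Pos r → Pos r′ → VV l u v m r → VV l u v m r′ → r ≡ r′
vv-forward-unique {l} {u} {v} {m} {r} {r′} rₚ rₚ′ (z , s) (z′ , s′) = at-ext rₚ rₚ′ e
  where
  e : ∀ n → at r n ≡ at r′ n
  e zero    = trans z (sym z′)
  e (suc n) = +-cancelʳ-≡ (at l n) _ _ (trans (s n) (sym (s′ n)))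

vv-backward-unique : ∀ {l l′ u v m m′ r} → Pos l → Pos l′ → VV l u v m r → VV l′ u v m′ r →
  l ≡ l′ × m ≡ m′
vv-backward-unique {u = u} {v} {r = r} lₚ lₚ′ (z , s) (z′ , s′) =
  at-ext lₚ lₚ′ (λ n → +-cancelˡ-≡ (at r (suc n)) _ _ (trans (s n) (sym (s′ n)))) ,
  +-cancelˡ-≡ (at u 0 ⊔ at v 0) _ _ (trans (sym z) z′)

max+min : ∀ a b → (a ⊔ b) + (a ⊓ b) ≡ a + b
max+min a b with ≤-total a b
... | inj₁ le rewrite m≤n⇒m⊔n≡n le | m≤n⇒m⊓n≡m le = +-comm b a
... | inj₂ le rewrite m≥n⇒m⊔n≡m le | m≥n⇒m⊓n≡n le = refl

-- Summed over all columns, the maxima and minima of the rule recombine by `max+min` into the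
-- entries of `u` and `v`.
vv-sum : ∀ {l u v m r} → Step V l u → VV l u v m r → sum r + sum l ≡ sum u + sum v + m
vv-sum {l} {u} {v} {m} {r} lu (z , s) = begin
  sum r + sum l
    ≡⟨ cong₂ _+_ (sumTo-at r (suc N) (m≤n⇒m≤1+n r≤)) (sumTo-at l N l≤) ⟨
  sumTo (suc N) (at r) + sumTo N (at l)
    ≡⟨ +-identityʳ _ ⟨
  sumTo (suc N) (at r) + sumTo N (at l) + 0
    ≡⟨ cong (sumTo (suc N) (at r) + sumTo N (at l) +_) min0 ⟨
  sumTo (suc N) (at r) + sumTo N (at l) + (at u N ⊓ at v N)
    ≡⟨ partial N ⟩
  sumTo (suc N) (at u) + sumTo (suc N) (at v) + m
    ≡⟨ cong (_+ m) (cong₂ _+_ (sumTo-at u (suc N) (m≤n⇒m≤1+n u≤)) (sumTo-at v (suc N) (m≤n⇒m≤1+n v≤))) ⟩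
  sum u + sum v + m ∎
  where
  open ≡-Reasoning
  N = length r + (length l + (length u + length v))
  r≤ : length r ≤ N
  r≤ = m≤m+n _ _
  l≤ : length l ≤ N
  l≤ = ≤-trans (m≤m+n _ _) (m≤n+m _ (length r))
  u≤ : length u ≤ N
  u≤ = ≤-trans (m≤m+n _ (length v)) (≤-trans (m≤n+m _ (length l)) (m≤n+m _ (length r)))
  v≤ : length v ≤ N
  v≤ = ≤-trans (m≤n+m _ (length u)) (≤-trans (m≤n+m _ (length l)) (m≤n+m _ (length r)))
  min0 : at u N ⊓ at v N ≡ 0
  min0 rewrite at-beyond u u≤ = refl
  -- The rule pairs `r` in column `n + 1` with `l` in column `n`, so `r` runs one column ahead and
  -- the minimum of the last column is still pending. It vanishes beyond the length of `u`.
  partial : ∀ N → sumTo (suc N) (at r) + sumTo N (at l) + (at u N ⊓ at v N) ≡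
                  sumTo (suc N) (at u) + sumTo (suc N) (at v) + m
  partial zero rewrite z = trans (lem (at u 0 ⊔ at v 0) m (at u 0 ⊓ at v 0)) (cong (_+ m) (max+min (at u 0) (at v 0)))
    where
    lem : ∀ x m y → x + m + 0 + y ≡ x + y + m
    lem = solve-∀
  partial (suc N) = begin
    R + at r (suc N) + (L + at l N) + mn′   ≡⟨ lem₁ R (at r (suc N)) L (at l N) mn′ ⟩
    R + L + (at r (suc N) + at l N) + mn′   ≡⟨ cong (λ x → R + L + x + mn′) (s N) ⟩
    R + L + (mx′ + mn) + mn′                ≡⟨ lem₂ R L mx′ mn mn′ ⟩
    R + L + mn + (mx′ + mn′)                ≡⟨ cong₂ _+_ (partial N) (max+min (at u (suc N)) (at v (suc N))) ⟩
    U + W + m + (at u (suc N) + at v (suc N)) ≡⟨ lem₃ U W m (at u (suc N)) (at v (suc N)) ⟩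
    U + at u (suc N) + (W + at v (suc N)) + m ∎
    where
    R = sumTo (suc N) (at r)
    L = sumTo N (at l)
    U = sumTo (suc N) (at u)
    W = sumTo (suc N) (at v)
    mx′ = at u (suc N) ⊔ at v (suc N)
    mn = at u N ⊓ at v N
    mn′ = at u (suc N) ⊓ at v (suc N)
    lem₁ : ∀ R r L l y → R + r + (L + l) + y ≡ R + L + (r + l) + y
    lem₁ = solve-∀
    lem₂ : ∀ R L x y z → R + L + (x + y) + z ≡ R + L + y + (x + z)
    lem₂ = solve-∀
    lem₃ : ∀ U W m a b → U + W + m + (a + b) ≡ U + a + (W + b) + m
    lem₃ = solve-∀

HH : (l u v : List ℕ) → ℕ → List ℕ → Set
HH l u v m r = VV (heights l) (heights u) (heights v) m (heights r)

-- A bit c is passed through the columns: at a free column (u ≤ v) it becomes the increment of v and is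
-- replaced by the increment u − l; at a locked one (u = v + 1) all increments are forced and it passes unchanged.
data Carry (l u v r c c′ : ℕ) : Set where
  free : u ≤ v → r ≡ v + c → u ≡ l + c′ → Carry l u v r c c′
  lock : u ≡ suc v → c′ ≡ c → l ≡ v → r ≡ u → Carry l u v r c c′

-- The matrix entry enters as the first bit. By `carry-beyond` no bit is left over once `u` and `r`
-- have ended.
HV : (l u v : List ℕ) → ℕ → List ℕ → Set
HV l u v m r = Σ (ℕ → ℕ) λ c → c 0 ≡ m × (∀ n → Carry (at l n) (at u n) (at v n) (at r n) (c n) (c (suc n)))

hv-forward : ∀ {l u v} → Part l → Part u → Part v → Step H l u → Step V l v → ∀ {m} → m ≤ 1 →
  Σ (List ℕ) λ r → Part r × Step V u r × Step H v r × HV l u v m r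
hv-forward {l} {u} {v} (_ , dl) (_ , du) (_ , dv) lu lv {m} m≤1 =
  r , (fromFun-pos N f , dec-r) , ur , vr , c , refl , carry
  where
  c : ℕ → ℕ
  c zero = m
  c (suc n) with at u n ≤? at v n
  ... | yes _ = at u n ∸ at l n
  ... | no  _ = c n
  c≤1 : ∀ n → c n ≤ 1
  c≤1 zero = m≤1
  c≤1 (suc n) with at u n ≤? at v n
  ... | yes _ = m≤n+o⇒m∸n≤o (at u n) (at l n) (≤-trans (proj₂ (lu n)) (≤-reflexive (+-comm 1 (at l n))))
  ... | no  _ = c≤1 n
  f : ℕ → ℕ
  f n with at u n ≤? at v n
  ... | yes _ = at v n + c n
  ... | no  _ = at u n
  u≤f : ∀ n → at u n ≤ f n
  u≤f n with at u n ≤? at v n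
  ... | yes le = ≤-trans le (m≤m+n _ _)
  ... | no  _  = ≤-refl
  -- From `l ≤ v < u ≤ l + 1` everything in the column is forced.
  locked : ∀ n → ¬ at u n ≤ at v n → at u n ≡ suc (at v n) × at l n ≡ at v n
  locked n nle = ≤-antisym (≤-trans (proj₂ (lu n)) (s≤s (proj₁ (lv n)))) (≰⇒> nle) ,
    ≤-antisym (proj₁ (lv n)) (≤-pred (≤-trans (≰⇒> nle) (proj₂ (lu n))))
  -- This bound makes `u → r` a vertical strip. After a free column it reads `v (n + 1) ≤ l n`, as
  -- the bit is `u n − l n`; after a locked one, `u n = v n + 1` leaves room for any bit.
  next : ∀ n → at v (suc n) + c (suc n) ≤ at u n
  next n with at u n ≤? at v n
  ... | yes le = ≤-trans (+-monoˡ-≤ _ (proj₂ (lv n))) (≤-reflexive (m+[n∸m]≡n (proj₁ (lu n))))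
  ... | no nle with locked n nle
  ...   | e , e′ rewrite e = ≤-trans (+-mono-≤ (dv n) (c≤1 n)) (≤-reflexive (+-comm _ 1))
  f≤u : ∀ n → f (suc n) ≤ at u n
  f≤u n with next n | at u (suc n) ≤? at v (suc n)
  ... | q | yes le = q
  ... | q | no  _  = du n
  f-dec : ∀ n → f (suc n) ≤ f n
  f-dec n = ≤-trans (f≤u n) (u≤f n)
  N = suc (length u)
  f-zero : ∀ n → N ≤ n → f n ≡ 0
  f-zero (suc n) (s≤s le) = n≤0⇒n≡0 (≤-trans (f≤u n) (≤-reflexive (at-beyond u le)))
  r = fromFun N f
  at-r : ∀ n → at r n ≡ f n
  at-r = at-fromFun N f f-dec f-zero
  dec-r : Dec r
  dec-r n rewrite at-r n | at-r (suc n) = f-dec n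
  ur : Step V u r
  ur n rewrite at-r n | at-r (suc n) = u≤f n , f≤u n
  vr : Step H v r
  vr n rewrite at-r n with at u n ≤? at v n
  ... | yes le = m≤m+n _ _ , ≤-trans (+-monoʳ-≤ (at v n) (c≤1 n)) (≤-reflexive (+-comm _ 1))
  ... | no nle = <⇒≤ (≰⇒> nle) , ≤-reflexive (proj₁ (locked n nle))
  carry : ∀ n → Carry (at l n) (at u n) (at v n) (at r n) (c n) (c (suc n))
  carry n rewrite at-r n with at u n ≤? at v n
  ... | yes le = free le refl (sym (m+[n∸m]≡n (proj₁ (lu n))))
  ... | no nle = lock (proj₁ (locked n nle)) refl (proj₂ (locked n nle)) refl

∸-unfold : ∀ {n N} → n < N → N ∸ n ≡ suc (N ∸ suc n)
∸-unfold {zero}  {suc N} h       = refl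
∸-unfold {suc n} {suc N} (s≤s h) = ∸-unfold h

-- A locked column does not reveal its bit, so the bits are computed from the right and `l` is then
-- read off column by column.
hv-backward : ∀ {u v r} → Part u → Part v → Step V u r → Step H v r →
  Σ (List ℕ) λ l → Σ ℕ λ m → Part l × Step H l u × Step V l v × m ≤ 1 × HV l u v m r
hv-backward {u} {v} {r} (_ , du) (_ , dv) ur vr =
  l , c 0 , (fromFun-pos N f , dec-l) , lu , lv , c≤1 0 , c , refl , carry
  where
  N = length u
  -- The bit entering a locked column is the increment of `r` over `v` in the next free column. From
  -- column `length u` on all columns are free, so `N ∸ n` steps of search suffice.
  back : ℕ → ℕ → ℕ
  back zero    n = at r n ∸ at v n
  back (suc k) n with at u n ≤? at v n
  ... | yes _ = at r n ∸ at v n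
  ... | no  _ = back k (suc n)
  c : ℕ → ℕ
  c n = back (N ∸ n) n
  incr≤1 : ∀ n → at r n ∸ at v n ≤ 1
  incr≤1 n = m≤n+o⇒m∸n≤o (at r n) (at v n) (≤-trans (proj₂ (vr n)) (≤-reflexive (+-comm 1 (at v n))))
  back≤1 : ∀ k n → back k n ≤ 1
  back≤1 zero    n = incr≤1 n
  back≤1 (suc k) n with at u n ≤? at v n
  ... | yes _ = incr≤1 n
  ... | no  _ = back≤1 k (suc n)
  c≤1 : ∀ n → c n ≤ 1
  c≤1 n = back≤1 (N ∸ n) n
  c-free : ∀ n → at u n ≤ at v n → c n ≡ at r n ∸ at v n
  c-free n le with N ∸ n
  ... | zero = refl
  ... | suc k with at u n ≤? at v n
  ...   | yes _  = refl
  ...   | no nle = ⊥-elim (nle le)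
  c-lock : ∀ n → ¬ at u n ≤ at v n → c n ≡ c (suc n)
  c-lock n nle with n <? N
  ... | no q = ⊥-elim (nle (≤-trans (≤-reflexive (at-beyond u (≮⇒≥ q))) z≤n))
  ... | yes q rewrite ∸-unfold q with at u n ≤? at v n
  ...   | yes le = ⊥-elim (nle le)
  ...   | no _   = refl
  locked : ∀ n → ¬ at u n ≤ at v n → at u n ≡ suc (at v n) × at r n ≡ at u n
  locked n nle = ≤-antisym (≤-trans (proj₁ (ur n)) (proj₂ (vr n))) (≰⇒> nle) ,
    ≤-antisym (≤-trans (proj₂ (vr n)) (≰⇒> nle)) (proj₁ (ur n))
  next : ∀ n → at v (suc n) + c (suc n) ≤ at u n
  next n with at u (suc n) ≤? at v (suc n)
  ... | yes le rewrite c-free (suc n) le = ≤-trans (≤-reflexive (m+[n∸m]≡n (proj₁ (vr (suc n))))) (proj₂ (ur n))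
  ... | no nle with locked (suc n) nle
  ...   | e , _ = ≤-trans (+-monoʳ-≤ (at v (suc n)) (c≤1 (suc n)))
                    (≤-trans (≤-reflexive (trans (+-comm _ 1) (sym e))) (du n))
  f : ℕ → ℕ
  f n with at u n ≤? at v n
  ... | yes _ = at u n ∸ c (suc n)
  ... | no  _ = at v n
  f≤u : ∀ n → f n ≤ at u n
  f≤u n with at u n ≤? at v n
  ... | yes _  = m∸n≤m (at u n) (c (suc n))
  ... | no nle = <⇒≤ (≰⇒> nle)
  u≤f : ∀ n → at u n ≤ suc (f n)
  u≤f n with at u n ≤? at v n
  ... | yes _  = ≤-trans (m≤n+m∸n (at u n) (c (suc n))) (+-monoˡ-≤ _ (c≤1 (suc n)))
  ... | no nle = ≤-reflexive (proj₁ (locked n nle))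
  f≤v : ∀ n → f n ≤ at v n
  f≤v n with at u n ≤? at v n
  ... | yes le = ≤-trans (m∸n≤m (at u n) (c (suc n))) le
  ... | no _   = ≤-refl
  v≤f : ∀ n → at v (suc n) ≤ f n
  v≤f n with next n | at u n ≤? at v n
  ... | q | yes le = m+n≤o⇒m≤o∸n _ q
  ... | q | no _   = dv n
  f-dec : ∀ n → f (suc n) ≤ f n
  f-dec n = ≤-trans (f≤v (suc n)) (v≤f n)
  f-zero : ∀ n → N ≤ n → f n ≡ 0
  f-zero n le = n≤0⇒n≡0 (≤-trans (f≤u n) (≤-reflexive (at-beyond u le)))
  l = fromFun N f
  at-l : ∀ n → at l n ≡ f n
  at-l = at-fromFun N f f-dec f-zero
  dec-l : Dec l
  dec-l n rewrite at-l n | at-l (suc n) = f-dec n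
  lu : Step H l u
  lu n rewrite at-l n = f≤u n , u≤f n
  lv : Step V l v
  lv n rewrite at-l n = f≤v n , v≤f n
  carry : ∀ n → Carry (at l n) (at u n) (at v n) (at r n) (c n) (c (suc n))
  carry n rewrite at-l n with next n | at u n ≤? at v n
  ... | q | yes le = free le (trans (sym (m+[n∸m]≡n (proj₁ (vr n)))) (cong (at v n +_) (sym (c-free n le))))
                       (sym (m∸n+n≡m (≤-trans (m≤n+m _ (at v (suc n))) q)))
  ... | q | no nle = lock (proj₁ (locked n nle)) (sym (c-lock n nle)) refl (proj₂ (locked n nle))

private
  free∧lock : ∀ {u v} {A : Set} → u ≤ v → u ≡ suc v → A
  free∧lock le refl = ⊥-elim (1+n≰n le)

-- Whether a column is free depends on `u` and `v` alone, so both solutions take the same case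
-- everywhere; their bits agree from the left, starting with `m`.
hv-forward-unique : ∀ {l u v m r r′} → Pos r → Pos r′ → HV l u v m r → HV l u v m r′ → r ≡ r′
hv-forward-unique {l} {u} {v} {m} {r} {r′} rₚ rₚ′ (c , z , s) (c′ , z′ , s′) = at-ext rₚ rₚ′ same-r
  where
  same-c : ∀ n → c n ≡ c′ n
  same-c zero = trans z (sym z′)
  same-c (suc n) with s n | s′ n
  ... | free _ _ e   | free _ _ e′   = +-cancelˡ-≡ (at l n) _ _ (trans (sym e) e′)
  ... | free le _ _  | lock e _ _ _  = free∧lock le e
  ... | lock e _ _ _ | free le _ _   = free∧lock le e
  ... | lock _ e _ _ | lock _ e′ _ _ = trans e (trans (same-c n) (sym e′))
  same-r : ∀ n → at r n ≡ at r′ n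
  same-r n with s n | s′ n
  ... | free _ e _   | free _ e′ _   = trans e (trans (cong (at v n +_) (same-c n)) (sym e′))
  ... | free le _ _  | lock e _ _ _  = free∧lock le e
  ... | lock e _ _ _ | free le _ _   = free∧lock le e
  ... | lock _ _ _ e | lock _ _ _ e′ = trans e (sym e′)

carry-beyond : ∀ {l u v r c c′} → u ≡ 0 → r ≡ 0 → Carry l u v r c c′ → c ≡ 0
carry-beyond {v = v} _ rz (free _ e _) = m+n≡0⇒n≡0 v (trans (sym e) rz)
carry-beyond uz _ (lock e _ _ _) with () ← trans (sym uz) e

-- Here the bits agree from the right: both vanish beyond `u` and `r`, a free column determines its
-- incoming bit from `r`, and a locked one copies the bit that leaves it.
hv-backward-unique : ∀ {l l′ u v m m′ r} → Pos l → Pos l′ → HV l u v m r → HV l′ u v m′ r →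
  l ≡ l′ × m ≡ m′
hv-backward-unique {l} {l′} {u} {v} {m} {m′} {r} lₚ lₚ′ (c , z , s) (c′ , z′ , s′) =
  at-ext lₚ lₚ′ same-l , trans (sym z) (trans (same-c 0) z′)
  where
  N = length u + length r
  beyond : ∀ n → N ≤ n → c n ≡ c′ n
  beyond n le = trans (carry-beyond uz rz (s n)) (sym (carry-beyond uz rz (s′ n)))
    where
    uz = at-beyond u (≤-trans (m≤m+n _ _) le)
    rz = at-beyond r (≤-trans (m≤n+m _ _) le)
  descend : ∀ k n → N ≤ n + k → c n ≡ c′ n
  descend zero    n le = beyond n (≤-trans le (≤-reflexive (+-identityʳ n)))
  descend (suc k) n le with s n | s′ n
  ... | free _ e _   | free _ e′ _   = +-cancelˡ-≡ (at v n) _ _ (trans (sym e) e′)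
  ... | free le′ _ _ | lock e _ _ _  = free∧lock le′ e
  ... | lock e _ _ _ | free le′ _ _  = free∧lock le′ e
  ... | lock _ e _ _ | lock _ e′ _ _ =
    trans (sym e) (trans (descend k (suc n) (≤-trans le (≤-reflexive (+-suc n k)))) e′)
  same-c : ∀ n → c n ≡ c′ n
  same-c n = descend N n (m≤n+m N n)
  same-l : ∀ n → at l n ≡ at l′ n
  same-l n with s n | s′ n
  ... | free _ _ e   | free _ _ e′   =
    +-cancelʳ-≡ (c (suc n)) _ _ (trans (sym e) (trans e′ (cong (at l′ n +_) (sym (same-c (suc n))))))
  ... | free le _ _  | lock e _ _ _  = free∧lock le e
  ... | lock e _ _ _ | free le _ _   = free∧lock le e
  ... | lock _ _ e _ | lock _ _ e′ _ = trans e (sym e′)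

-- Every column, free or locked, satisfies `r + l + c′ = u + v + c`, so the bits telescope from `m`
-- to zero.
hv-sum : ∀ {l u v m r} → HV l u v m r → sum r + sum l ≡ sum u + sum v + m
hv-sum {l} {u} {v} {m} {r} (c , z , s) = begin
  sum r + sum l
    ≡⟨ cong₂ _+_ (sumTo-at r N r≤) (sumTo-at l N l≤) ⟨
  sumTo N (at r) + sumTo N (at l)
    ≡⟨ +-identityʳ _ ⟨
  sumTo N (at r) + sumTo N (at l) + 0
    ≡⟨ cong (sumTo N (at r) + sumTo N (at l) +_) (carry-beyond (at-beyond u u≤) (at-beyond r r≤) (s N)) ⟨
  sumTo N (at r) + sumTo N (at l) + c N
    ≡⟨ partial N ⟩
  sumTo N (at u) + sumTo N (at v) + m
    ≡⟨ cong (_+ m) (cong₂ _+_ (sumTo-at u N u≤) (sumTo-at v N v≤)) ⟩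
  sum u + sum v + m ∎
  where
  open ≡-Reasoning
  N = length r + (length l + (length u + length v))
  r≤ : length r ≤ N
  r≤ = m≤m+n _ _
  l≤ : length l ≤ N
  l≤ = ≤-trans (m≤m+n _ _) (m≤n+m _ (length r))
  u≤ : length u ≤ N
  u≤ = ≤-trans (m≤m+n _ (length v)) (≤-trans (m≤n+m _ (length l)) (m≤n+m _ (length r)))
  v≤ : length v ≤ N
  v≤ = ≤-trans (m≤n+m _ (length u)) (≤-trans (m≤n+m _ (length l)) (m≤n+m _ (length r)))
  column : ∀ {l u v r c c′} → Carry l u v r c c′ → r + l + c′ ≡ u + v + c
  column {l} {u} {v} {r} {c} {c′} (free _ e e′) rewrite e | e′ = lem v c l c′
    where
    lem : ∀ v c l c′ → v + c + l + c′ ≡ l + c′ + v + c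
    lem = solve-∀
  column (lock _ refl refl refl) = refl
  partial : ∀ N → sumTo N (at r) + sumTo N (at l) + c N ≡ sumTo N (at u) + sumTo N (at v) + m
  partial zero    = z
  partial (suc N) = begin
    R + at r N + (L + at l N) + c (suc N)   ≡⟨ lem₁ R (at r N) L (at l N) (c (suc N)) ⟩
    R + L + (at r N + at l N + c (suc N))   ≡⟨ cong (R + L +_) (column (s N)) ⟩
    R + L + (at u N + at v N + c N)         ≡⟨ lem₂ R L (at u N) (at v N) (c N) ⟩
    R + L + c N + (at u N + at v N)         ≡⟨ cong (_+ (at u N + at v N)) (partial N) ⟩
    U + W + m + (at u N + at v N)           ≡⟨ lem₃ U W m (at u N) (at v N) ⟩
    U + at u N + (W + at v N) + m ∎
    where
    R = sumTo N (at r)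
    L = sumTo N (at l)
    U = sumTo N (at u)
    W = sumTo N (at v)
    lem₁ : ∀ R r L l y → R + r + (L + l) + y ≡ R + L + (r + l + y)
    lem₁ = solve-∀
    lem₂ : ∀ R L x y z → R + L + (x + y + z) ≡ R + L + z + (x + y)
    lem₂ = solve-∀
    lem₃ : ∀ U W m a b → U + W + m + (a + b) ≡ U + a + (W + b) + m
    lem₃ = solve-∀

-- Squares: the local rules for all four pairs of strip types

Rule : Tag → Tag → (l u v : List ℕ) → ℕ → List ℕ → Set
Rule H H l u v = HH l u v
Rule H V l u v = HV l u v
Rule V H l u v = HV l v u
Rule V V l u v = VV l u v

Bound : Tag → Tag → ℕ → Set
Bound H H m = ⊤
Bound H V m = m ≤ 1
Bound V H m = m ≤ 1
Bound V V m = ⊤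

record Square (σ τ : Tag) (l u v : List ℕ) (m : ℕ) (r : List ℕ) : Set where
  field
    part-l : Part l
    part-u : Part u
    part-v : Part v
    part-r : Part r
    step-lu : Step σ l u
    step-lv : Step τ l v
    step-ur : Step τ u r
    step-vr : Step σ v r
    bound   : Bound σ τ m
    rule    : Rule σ τ l u v m r

open Square

conj-V-involutive : ∀ {p q} → Part p → Part q → Step V (heights p) (heights q) → Step H p q
conj-V-involutive {p} {q} pp pq s = subst₂ (Step H) (heights-involutive pp) (heights-involutive pq) (conj-V {heights p} {heights q} s)

square-forward : ∀ σ τ {l u v m} → Part l → Part u → Part v → Step σ l u → Step τ l v → Bound σ τ m →
  ∃ λ r → Square σ τ l u v m r
square-forward H H {l} {u} {v} {m} lₚ uₚ vₚ lu lv b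
  with vv-forward {heights l} {heights u} {heights v} (conj-H {l} {u} lu) (conj-H {l} {v} lv) m
... | r , rₚ , ur , vr , rl = heights r , record
  { part-l = lₚ ; part-u = uₚ ; part-v = vₚ ; part-r = heights-part r ; step-lu = lu ; step-lv = lv
  ; step-ur = conj-V-involutive uₚ (heights-part r) (subst (Step V (heights u)) (sym (heights-involutive rₚ)) ur)
  ; step-vr = conj-V-involutive vₚ (heights-part r) (subst (Step V (heights v)) (sym (heights-involutive rₚ)) vr)
  ; bound = b ; rule = subst (VV (heights l) (heights u) (heights v) m) (sym (heights-involutive rₚ)) rl }
square-forward H V {l} {u} {v} lₚ uₚ vₚ lu lv b with hv-forward {l} {u} {v} lₚ uₚ vₚ lu lv b
... | r , rₚ , ur , vr , rl = r , record
  { part-l = lₚ ; part-u = uₚ ; part-v = vₚ ; part-r = rₚ ; step-lu = lu ; step-lv = lv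
  ; step-ur = ur ; step-vr = vr ; bound = b ; rule = rl }
square-forward V H {l} {u} {v} lₚ uₚ vₚ lu lv b with hv-forward {l} {v} {u} lₚ vₚ uₚ lv lu b
... | r , rₚ , vr , ur , rl = r , record
  { part-l = lₚ ; part-u = uₚ ; part-v = vₚ ; part-r = rₚ ; step-lu = lu ; step-lv = lv
  ; step-ur = ur ; step-vr = vr ; bound = b ; rule = rl }
square-forward V V {l} {u} {v} {m} lₚ uₚ vₚ lu lv b with vv-forward {l} {u} {v} lu lv m
... | r , rₚ , ur , vr , rl = r , record
  { part-l = lₚ ; part-u = uₚ ; part-v = vₚ ; part-r = rₚ ; step-lu = lu ; step-lv = lv
  ; step-ur = ur ; step-vr = vr ; bound = b ; rule = rl }

square-backward : ∀ σ τ {u v r} → Part u → Part v → Part r → Step τ u r → Step σ v r →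
  ∃ λ l → ∃ λ m → Square σ τ l u v m r
square-backward H H {u} {v} {r} uₚ vₚ rₚ ur vr
  with vv-backward {heights u} {heights v} {heights r} (heights-part u) (conj-H {u} {r} ur) (conj-H {v} {r} vr)
... | l , m , lₚ , lu , lv , rl = heights l , m , record
  { part-l = heights-part l ; part-u = uₚ ; part-v = vₚ ; part-r = rₚ
  ; step-lu = conj-V-involutive (heights-part l) uₚ (subst (λ p → Step V p (heights u)) (sym (heights-involutive lₚ)) lu)
  ; step-lv = conj-V-involutive (heights-part l) vₚ (subst (λ p → Step V p (heights v)) (sym (heights-involutive lₚ)) lv)
  ; step-ur = ur ; step-vr = vr ; bound = tt
  ; rule = subst (λ p → VV p (heights u) (heights v) m (heights r)) (sym (heights-involutive lₚ)) rl }
square-backward H V {u} {v} {r} uₚ vₚ rₚ ur vr with hv-backward {u} {v} {r} uₚ vₚ ur vr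
... | l , m , lₚ , lu , lv , b , rl = l , m , record
  { part-l = lₚ ; part-u = uₚ ; part-v = vₚ ; part-r = rₚ ; step-lu = lu ; step-lv = lv
  ; step-ur = ur ; step-vr = vr ; bound = b ; rule = rl }
square-backward V H {u} {v} {r} uₚ vₚ rₚ ur vr with hv-backward {v} {u} {r} vₚ uₚ vr ur
... | l , m , lₚ , lv , lu , b , rl = l , m , record
  { part-l = lₚ ; part-u = uₚ ; part-v = vₚ ; part-r = rₚ ; step-lu = lu ; step-lv = lv
  ; step-ur = ur ; step-vr = vr ; bound = b ; rule = rl }
square-backward V V {u} {v} {r} uₚ vₚ rₚ ur vr with vv-backward {u} {v} {r} uₚ ur vr
... | l , m , lₚ , lu , lv , rl = l , m , record
  { part-l = lₚ ; part-u = uₚ ; part-v = vₚ ; part-r = rₚ ; step-lu = lu ; step-lv = lv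
  ; step-ur = ur ; step-vr = vr ; bound = tt ; rule = rl }

square-forward-unique : ∀ σ τ {l u v m r r′} → Square σ τ l u v m r → Square σ τ l u v m r′ → r ≡ r′
square-forward-unique H H {l} {u} {v} {m} {r} {r′} s s′ = heights-inj (part-r s) (part-r s′)
  (vv-forward-unique {heights l} {heights u} {heights v} (heights-pos r) (heights-pos r′) (rule s) (rule s′))
square-forward-unique H V {l} {u} {v} s s′ =
  hv-forward-unique {l} {u} {v} (proj₁ (part-r s)) (proj₁ (part-r s′)) (rule s) (rule s′)
square-forward-unique V H {l} {u} {v} s s′ =
  hv-forward-unique {l} {v} {u} (proj₁ (part-r s)) (proj₁ (part-r s′)) (rule s) (rule s′)
square-forward-unique V V {l} {u} {v} s s′ =
  vv-forward-unique {l} {u} {v} (proj₁ (part-r s)) (proj₁ (part-r s′)) (rule s) (rule s′)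

square-backward-unique : ∀ σ τ {l l′ u v m m′ r} → Square σ τ l u v m r → Square σ τ l′ u v m′ r →
  l ≡ l′ × m ≡ m′
square-backward-unique H H {l} {l′} {u} {v} {r = r} s s′
  with vv-backward-unique {u = heights u} {heights v} {r = heights r} (heights-pos l) (heights-pos l′) (rule s) (rule s′)
... | e , e′ = heights-inj (part-l s) (part-l s′) e , e′
square-backward-unique H V {u = u} {v} {r = r} s s′ =
  hv-backward-unique {u = u} {v} {r = r} (proj₁ (part-l s)) (proj₁ (part-l s′)) (rule s) (rule s′)
square-backward-unique V H {u = u} {v} {r = r} s s′ =
  hv-backward-unique {u = v} {u} {r = r} (proj₁ (part-l s)) (proj₁ (part-l s′)) (rule s) (rule s′)
square-backward-unique V V {u = u} {v} {r = r} s s′ =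
  vv-backward-unique {u = u} {v} {r = r} (proj₁ (part-l s)) (proj₁ (part-l s′)) (rule s) (rule s′)

square-sum : ∀ σ τ {l u v m r} → Square σ τ l u v m r → sum r + sum l ≡ sum u + sum v + m
square-sum H H {l} {u} {v} {m} {r} s =
  subst₂ _≡_ (cong₂ _+_ (sum-heights r) (sum-heights l))
    (cong (_+ m) (cong₂ _+_ (sum-heights u) (sum-heights v)))
    (vv-sum {heights l} {heights u} {heights v} {m} {heights r} (conj-H {l} {u} (step-lu s)) (rule s))
square-sum H V {l} {u} {v} {r = r} s = hv-sum {l} {u} {v} {r = r} (rule s)
square-sum V H {l} {u} {v} {m} {r} s =
  trans (hv-sum {l} {v} {u} {r = r} (rule s)) (cong (_+ m) (+-comm (sum v) (sum u)))
square-sum V V {l} {u} {v} {r = r} s = vv-sum {l} {u} {v} {r = r} (step-lu s) (rule s)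

-- Growth diagrams

-- A chain ∅ = p₀ ⊂ … ⊂ pₙ of partitions is stored as pₙ ∷ … ∷ p₁ ∷ [].
Chain : ℕ → Set
Chain n = Vec (List ℕ) n

top : ∀ {n} → Chain n → List ℕ
top []       = []
top (p ∷ ps) = p

[]-part : Part []
[]-part = [] , (λ _ → z≤n)

data Strips : ∀ {n} → Vec Tag n → Chain n → Set where
  []   : Strips [] []
  cons : ∀ {n t p} {ts : Vec Tag n} {ps} →
         Part p → Step t (top ps) p → Strips ts ps → Strips (t ∷ ts) (p ∷ ps)

top-part : ∀ {n} {ts : Vec Tag n} {ps} → Strips ts ps → Part (top ps)
top-part []            = []-part
top-part (cons pp _ _) = pp

empty-strips : ∀ {n} (ts : Vec Tag n) → Strips ts (Vec.replicate n [])
empty-strips []       = []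
empty-strips {suc n} (t ∷ ts) = cons []-part (subst (λ p → Step t p []) (sym (top-empty n)) (step-[] t)) (empty-strips ts)
  where
  top-empty : ∀ n → top (Vec.replicate n []) ≡ []
  top-empty zero    = refl
  top-empty (suc n) = refl

strips-into-[] : ∀ {n} {ts : Vec Tag n} {ps} → Strips ts ps → top ps ≡ [] → ps ≡ Vec.replicate n []
strips-into-[] []                  e    = refl
strips-into-[] (cons {t = t} _ s c) refl =
  cong ([] ∷_) (strips-into-[] c (step-into-[] t (top-part c) s))

-- One row of squares: `ps` runs along the lower edge, `qs` along the upper edge, and the left edge
-- consists of empty partitions.
data Row : ∀ {n} → Vec Tag n → Tag → Chain n → Vec ℕ n → Chain n → Set where
  []   : ∀ {τ} → Row [] τ [] [] []
  cons : ∀ {n τ t p m q} {ts : Vec Tag n} {ps ms qs} →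
         Row ts τ ps ms qs → Square t τ (top ps) p (top qs) m q →
         Row (t ∷ ts) τ (p ∷ ps) (m ∷ ms) (q ∷ qs)

data Bounded : ∀ {n} → Vec Tag n → Tag → Vec ℕ n → Set where
  []   : ∀ {τ} → Bounded [] τ []
  cons : ∀ {n τ t m} {ts : Vec Tag n} {ms} → Bound t τ m → Bounded ts τ ms → Bounded (t ∷ ts) τ (m ∷ ms)

open Square

row-bounded : ∀ {n τ} {ts : Vec Tag n} {ps ms qs} → Row ts τ ps ms qs → Bounded ts τ ms
row-bounded []         = []
row-bounded (cons r s) = cons (bound s) (row-bounded r)

row-step : ∀ {n τ} {ts : Vec Tag n} {ps ms qs} → Row ts τ ps ms qs → Step τ (top ps) (top qs)
row-step {τ = τ} []         = step-[] τ
row-step         (cons r s) = step-ur s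

row-forward : ∀ {n} τ {ts : Vec Tag n} {ps ms} → Strips ts ps → Bounded ts τ ms →
              ∃ λ qs → Strips ts qs × Row ts τ ps ms qs
row-forward τ []                          []         = [] , [] , []
row-forward τ (cons {t = t} pp st c) (cons b bs) with row-forward τ c bs
... | qs , c′ , r with square-forward t τ (top-part c) pp (top-part c′) st (row-step r) b
...   | q , s = q ∷ qs , cons (part-r s) (step-vr s) c′ , cons r s

-- Squares are solved from the right end, each handing its corner `l` to its left neighbour. At the
-- left end a strip into the empty partition starts from the empty partition.
row-backward : ∀ {n} τ {ts : Vec Tag n} {qs p} → Strips ts qs → Part p → Step τ p (top qs) →
               ∃ λ ps → ∃ λ ms → Strips ts ps × Row ts τ ps ms qs × top ps ≡ p
row-backward τ []                        pp sp = [] , [] , [] , [] , sym (step-into-[] τ pp sp)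
row-backward τ {p = p} (cons {t = t} pq st c) pp sp with square-backward t τ pp (top-part c) pq sp st
... | l , m , s with row-backward τ c (part-l s) (step-lv s)
...   | ps , ms , c′ , r , refl = p ∷ ps , m ∷ ms , cons pp (step-lu s) c′ , cons r s , refl

row-forward-unique : ∀ {n τ} {ts : Vec Tag n} {ps ms qs qs′} →
                     Row ts τ ps ms qs → Row ts τ ps ms qs′ → qs ≡ qs′
row-forward-unique []                 []           = refl
row-forward-unique {τ = τ} (cons {t = t} r s) (cons r′ s′) with refl ← row-forward-unique r r′ =
  cong (_∷ _) (square-forward-unique t τ s s′)

row-backward-unique : ∀ {n τ} {ts : Vec Tag n} {ps ps′ ms ms′ qs} →
                      Row ts τ ps ms qs → Row ts τ ps′ ms′ qs → top ps ≡ top ps′ → ps ≡ ps′ × ms ≡ ms′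
row-backward-unique []                 []           _ = refl , refl
row-backward-unique {τ = τ} (cons {t = t} r s) (cons r′ s′) refl with square-backward-unique t τ s s′
... | e , refl with refl , refl ← row-backward-unique r r′ e = refl , refl

-- Rows are stacked on an empty lower edge; the two chains run along the upper and the right edge.
data Growth {n} (ts : Vec Tag n) : ∀ {k} → Vec Tag k → Vec (Vec ℕ n) k → Chain n → Chain k → Set where
  []   : Growth ts [] [] (Vec.replicate n []) []
  cons : ∀ {k τ} {us : Vec Tag k} {M ms ps ps′ qs} → Growth ts us M ps qs → Row ts τ ps ms ps′ →
         Growth ts (τ ∷ us) (ms ∷ M) ps′ (top ps′ ∷ qs)

growth-top : ∀ {n k} {ts : Vec Tag n} {us : Vec Tag k} {M ps qs} → Growth ts us M ps qs → top ps ≡ top qs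
growth-top {zero}  []         = refl
growth-top {suc n} []         = refl
growth-top         (cons g r) = refl

data AllBounded {n} (ts : Vec Tag n) : ∀ {k} → Vec Tag k → Vec (Vec ℕ n) k → Set where
  []   : AllBounded ts [] []
  cons : ∀ {k τ} {us : Vec Tag k} {M ms} → Bounded ts τ ms → AllBounded ts us M → AllBounded ts (τ ∷ us) (ms ∷ M)

growth-bounded : ∀ {n k} {ts : Vec Tag n} {us : Vec Tag k} {M ps qs} → Growth ts us M ps qs → AllBounded ts us M
growth-bounded []         = []
growth-bounded (cons g r) = cons (row-bounded r) (growth-bounded g)

growth-forward : ∀ {n k} (ts : Vec Tag n) {us : Vec Tag k} {M} → AllBounded ts us M →
                 ∃ λ ps → ∃ λ qs → Strips ts ps × Strips us qs × Growth ts us M ps qs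
growth-forward ts [] = _ , [] , empty-strips ts , [] , []
growth-forward ts (cons {τ = τ} b bs) with growth-forward ts bs
... | ps , qs , c , d , g with row-forward τ c b
...   | ps′ , c′ , r = ps′ , top ps′ ∷ qs , c′ ,
        cons (top-part c′) (subst (λ q → Step τ q (top ps′)) (growth-top g) (row-step r)) d , cons g r

-- The next partition down the right edge is the corner from which `row-backward` peels off the last
-- row. When no rows are left, the shared corner is empty and with it the whole chain.
growth-backward : ∀ {n k} {ts : Vec Tag n} {us : Vec Tag k} {ps qs} → Strips ts ps → Strips us qs →
                  top ps ≡ top qs → ∃ λ M → Growth ts us M ps qs
growth-backward c [] e with refl ← strips-into-[] c e = [] , []
growth-backward c (cons {t = τ} pq s d) refl with row-backward τ c (top-part d) s
... | ps , ms , c′ , r , e with growth-backward c′ d e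
...   | M , g = ms ∷ M , cons g r

growth-forward-unique : ∀ {n k} {ts : Vec Tag n} {us : Vec Tag k} {M ps ps′ qs qs′} →
                        Growth ts us M ps qs → Growth ts us M ps′ qs′ → ps ≡ ps′ × qs ≡ qs′
growth-forward-unique []         []           = refl , refl
growth-forward-unique (cons g r) (cons g′ r′)
  with refl , refl ← growth-forward-unique g g′
  with refl ← row-forward-unique r r′ = refl , refl

growth-backward-unique : ∀ {n k} {ts : Vec Tag n} {us : Vec Tag k} {M M′ ps qs} →
                         Growth ts us M ps qs → Growth ts us M′ ps qs → M ≡ M′
growth-backward-unique []         []           = refl
growth-backward-unique (cons g r) (cons g′ r′)
  with refl , refl ← row-backward-unique r r′ (trans (growth-top g) (sym (growth-top g′))) =
  cong (_ ∷_) (growth-backward-unique g g′)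

-- Weights along the edges of a growth diagram

data Weights : ∀ {n} → Chain n → Vec ℕ n → Set where
  []   : Weights [] []
  cons : ∀ {n p w} {ps : Chain n} {ws} → sum p ≡ sum (top ps) + w → Weights ps ws → Weights (p ∷ ps) (w ∷ ws)

-- By the size identity of a square, the increment along its right edge exceeds that along its left
-- edge by the entry; across the row these entries add up.
row-sum : ∀ {n τ} {ts : Vec Tag n} {ps ms qs} → Row ts τ ps ms qs → sum (top qs) ≡ sum (top ps) + Vec.sum ms
row-sum [] = refl
row-sum {τ = τ} (cons {t = t} {p} {m} {q} {ps = ps} {ms} {qs} r s) = +-cancelʳ-≡ (sum (top ps)) _ _ (begin
  sum q + sum (top ps)                            ≡⟨ square-sum t τ s ⟩
  sum p + sum (top qs) + m                        ≡⟨ cong (λ x → sum p + x + m) (row-sum r) ⟩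
  sum p + (sum (top ps) + Vec.sum ms) + m         ≡⟨ lem (sum p) (sum (top ps)) (Vec.sum ms) m ⟩
  sum p + (m + Vec.sum ms) + sum (top ps)         ∎)
  where
  open ≡-Reasoning
  lem : ∀ p l s m → p + (l + s) + m ≡ p + (m + s) + l
  lem = solve-∀

-- The same identity read vertically: the increment along the upper edge of a square exceeds that
-- along the lower edge by the entry.
row-weights : ∀ {n τ} {ts : Vec Tag n} {ps ms qs ws} → Row ts τ ps ms qs → Weights ps ws →
              Weights qs (Vec.zipWith _+_ ms ws)
row-weights [] [] = []
row-weights {τ = τ} (cons {t = t} {p} {m} {q} {ps = ps} {ms} {qs} r s) (cons {w = w} e es) =
  cons (+-cancelʳ-≡ (sum (top ps)) _ _ (begin
    sum q + sum (top ps)                  ≡⟨ square-sum t τ s ⟩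
    sum p + sum (top qs) + m              ≡⟨ cong (λ x → x + sum (top qs) + m) e ⟩
    sum (top ps) + w + sum (top qs) + m   ≡⟨ lem (sum (top ps)) w (sum (top qs)) m ⟩
    sum (top qs) + (m + w) + sum (top ps) ∎))
  (row-weights r es)
  where
  open ≡-Reasoning
  lem : ∀ l w q m → l + w + q + m ≡ q + (m + w) + l
  lem = solve-∀

columnSums : ∀ {n k} → Vec (Vec ℕ n) k → Vec ℕ n
columnSums {n} []   = Vec.replicate n 0
columnSums (ms ∷ M) = Vec.zipWith _+_ ms (columnSums M)

growth-weights : ∀ {n k} {ts : Vec Tag n} {us : Vec Tag k} {M ps qs} → Growth ts us M ps qs →
                 Weights ps (columnSums M) × Weights qs (Vec.map Vec.sum M)
growth-weights {n} [] = empty n , []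
  where
  empty : ∀ n → Weights (Vec.replicate n []) (Vec.replicate n 0)
  empty zero          = []
  empty (suc zero)    = cons refl []
  empty (suc (suc n)) = cons refl (empty (suc n))
growth-weights (cons {ps = ps} {ps′} g r) with growth-weights g
... | wp , wq = row-weights r wp ,
  cons (trans (row-sum r) (cong (λ p → sum p + _) (growth-top g))) wq

-- Adding one letter to a composition

-- Conditions (a) and (b) for the cells of α outside β, when these are filled with a new largest letter.
data Unobstructed (β α : List ℕ) : Tag → Set where
  horizontal :
    (∀ i j n → i < j → at β i ≤ n → n < at α i → at β j ≤ n → n ≤ at α j → 0 < at α j → ⊥) →
    Unobstructed β α H
  vertical : (∀ i → at α i ≤ suc (at β i)) →
    (∀ i j n → i < j → at β i ≤ n → n < at α i → at β j ≡ n → at α j ≡ n → 0 < at α j → ⊥) →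
    Unobstructed β α V

record Extends (τ : Tag) (β α : List ℕ) : Set where
  constructor extends
  field
    pos   : Pos α
    below : ∀ i → at β i ≤ at α i
    clear : Unobstructed β α τ

open Extends

cnt-tl-≤ : ∀ n β → cnt n (tl β) ≤ cnt n β
cnt-tl-≤ n []      = z≤n
cnt-tl-≤ n (b ∷ β) = m≤n+m _ _

-- The first row that gains a cell in column `n` accounts for the successor. By hypothesis no later
-- row gains one, so `cnt-mono` bounds the rest.
cnt-≤-suc : ∀ n α β → (∀ i j → i < j → at β i ≤ n → n < at α i → at β j ≤ n → n < at α j → ⊥) →
            cnt n α ≤ suc (cnt n β)
cnt-≤-suc n []      β h = z≤n
cnt-≤-suc n (a ∷ α) β h with n <? a | n <? at β 0
... | yes p | no q = +-mono-≤ (ind-≤1 n a) (≤-trans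
  (cnt-mono α (tl β) (λ i r → ≰⇒> (λ s → h 0 (suc i) (s≤s z≤n) (≮⇒≥ q) p (subst (_≤ n) (at-tl β i) s) r)))
  (cnt-tl-≤ n β))
... | no p | _ rewrite ind-≥ (≮⇒≥ p) =
  ≤-trans (cnt-≤-suc n α (tl β) (λ i j lt a b c d → h (suc i) (suc j) (s≤s lt)
            (subst (_≤ n) (at-tl β i) a) b (subst (_≤ n) (at-tl β j) c) d))
          (s≤s (cnt-tl-≤ n β))
... | yes p | yes q rewrite cnt-tl n β | ind-< p | ind-< q =
  s≤s (cnt-≤-suc n α (tl β) (λ i j lt a b c d → h (suc i) (suc j) (s≤s lt)
        (subst (_≤ n) (at-tl β i) a) b (subst (_≤ n) (at-tl β j) c) d))

extends-step : ∀ {τ β α} → Extends τ β α → Step τ (heights β) (heights α)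
extends-step {β = β} {α} (extends _ le (horizontal h)) n rewrite at-heights β n | at-heights α n =
  cnt-mono β α (λ i q → <-≤-trans q (le i)) ,
  cnt-≤-suc n α β (λ i j lt a b c d → h i j n lt a b c (<⇒≤ d) (≤-<-trans z≤n d))
extends-step {β = β} {α} (extends _ le (vertical s _)) n
  rewrite at-heights β n | at-heights α n | at-heights α (suc n) =
  cnt-mono β α (λ i q → <-≤-trans q (le i)) ,
  cnt-mono α β (λ i q → ≤-pred (≤-trans q (s i)))

cnt-< : ∀ n α → n < at α 0 → cnt n α ≡ suc (cnt n (tl α))
cnt-< n α h = trans (cnt-tl n α) (cong (_+ cnt n (tl α)) (ind-< h))

cnt-≥ : ∀ n α → at α 0 ≤ n → cnt n α ≡ cnt n (tl α)
cnt-≥ n α h = trans (cnt-tl n α) (cong (_+ cnt n (tl α)) (ind-≥ h))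

private
  shift : ∀ n α α′ → (∃ λ i → n < at (tl α′) i × at (tl α) i ≤ n) → ∃ λ i → n < at α′ i × at α i ≤ n
  shift n α α′ (i , r , s) = suc i , subst (n <_) (at-tl α′ i) r , subst (_≤ n) (at-tl α i) s

excess : ∀ n α α′ → cnt n α < cnt n α′ → ∃ λ i → n < at α′ i × at α i ≤ n
excess n α (a ∷ α′) h with n <? a | n <? at α 0
... | yes p | no q  = 0 , p , ≮⇒≥ q
... | yes p | yes q = shift n α (a ∷ α′)
  (excess n (tl α) α′ (≤-pred (subst₂ _<_ (cnt-< n α q) (cnt-< n (a ∷ α′) p) h)))
... | no p  | _     = shift n α (a ∷ α′)
  (excess n (tl α) α′ (≤-<-trans (cnt-tl-≤ n α) (subst (cnt n α <_) (cnt-≥ n (a ∷ α′) (≮⇒≥ p)) h)))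

-- Row `i` counts for `α` only; since `α′` has at least as many rows beyond `n`, some row must make
-- up for it.
pigeonhole : ∀ n α α′ i → cnt n α ≤ cnt n α′ → n < at α i → at α′ i ≤ n → ∃ λ j → n < at α′ j × at α j ≤ n
pigeonhole n α α′ zero le p q =
  shift n α α′ (excess n (tl α) (tl α′) (subst₂ _≤_ (cnt-< n α p) (cnt-≥ n α′ q) le))
pigeonhole n α α′ (suc i) le p q with n <? at α′ 0 | n <? at α 0
... | yes a | no b  = 0 , a , ≮⇒≥ b
... | yes a | yes b = shift n α α′ (pigeonhole n (tl α) (tl α′) i
  (≤-pred (subst₂ _≤_ (cnt-< n α b) (cnt-< n α′ a) le))
  (subst (n <_) (sym (at-tl α i)) p) (subst (_≤ n) (sym (at-tl α′ i)) q))
... | no a  | _     = shift n α α′ (pigeonhole n (tl α) (tl α′) i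
  (≤-trans (cnt-tl-≤ n α) (subst (cnt n α ≤_) (cnt-≥ n α′ (≮⇒≥ a)) le))
  (subst (n <_) (sym (at-tl α i)) p) (subst (_≤ n) (sym (at-tl α′ i)) q))

-- Row `j` ends just before column `n` in `α`, above a new cell in that column. In the vertical case
-- `α′` shows that row `j` has length `n` in `β` already, because it gains at most one cell there.
no-swap : ∀ {τ β α α′} n {i j} → Extends τ β α → i < j → at β i ≤ n → n < at α i → at β j ≤ n → at α j ≡ n →
          n < at α′ j → Extends τ β α′ → 0 < n → ⊥
no-swap n (extends _ _ (horizontal h)) lt a b c d _ _ 0<n =
  h _ _ n lt a b c (≤-reflexive (sym d)) (subst (0 <_) (sym d) 0<n)
no-swap n (extends _ _ (vertical _ h)) lt a b c d e (extends _ _ (vertical s _)) 0<n =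
  h _ _ n lt a b (≤-antisym c (≤-pred (≤-trans e (s _)))) d (subst (0 <_) (sym d) 0<n)

-- If column n tells α from α′ while the columns before it do not, then some row i reaches beyond n in α only
-- and some row j in α′ only; the lower one of them is obstructed by the upper one.
extends-next : ∀ {τ β α α′} → Extends τ β α → Extends τ β α′ → ∀ n → cnt n α ≡ cnt n α′ →
  (∀ m → m < n → ∀ i → m < at α i → m < at α′ i) → (∀ m → m < n → ∀ i → m < at α′ i → m < at α i) →
  ∀ i → n < at α i → n < at α′ i
extends-next {τ} {β} {α} {α′} e e′ n c f f′ i p with n <? at α′ i
... | yes q = q
... | no q with pigeonhole n α α′ i (≤-reflexive c) p (≮⇒≥ q)
...   | j , p′ , q′ = ⊥-elim (go n f f′ c p (≮⇒≥ q) p′ q′)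
  where
  -- Agreement in the column before `n` leaves row `j` no length below `n`.
  reach : ∀ n {α α′} {j} → (∀ m → m < n → ∀ i → m < at α′ i → m < at α i) →
          n < at α′ j → at α j ≤ n → at α j ≡ n
  reach zero    f p q = n≤0⇒n≡0 q
  reach (suc n) f p q = ≤-antisym q (f n ≤-refl _ (<-trans (n<1+n n) p))
  go : ∀ n → (∀ m → m < n → ∀ i → m < at α i → m < at α′ i) → (∀ m → m < n → ∀ i → m < at α′ i → m < at α i) →
       cnt n α ≡ cnt n α′ → n < at α i → at α′ i ≤ n → n < at α′ j → at α j ≤ n → ⊥
  go n f f′ c p q p′ q′ with <-cmp i j
  ... | tri≈ _ refl _ = <⇒≱ p q′
  -- Column 0 needs no obstruction: nonempty rows form an initial segment, so a nonempty row `j` has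
  -- no empty row below it.
  go zero f f′ c p q p′ q′ | tri< lt _ _ =
    <⇒≱ (pos-down (pos e′) i j (<⇒≤ lt) p′) q
  go zero f f′ c p q p′ q′ | tri> _ _ gt =
    <⇒≱ (pos-down (pos e) j i (<⇒≤ gt) p) q′
  go (suc n) f f′ c p q p′ q′ | tri< lt _ _ =
    no-swap (suc n) e lt (≤-trans (below e′ i) q) p (≤-trans (below e j) q′)
      (reach (suc n) {α} {α′} f′ p′ q′) p′ e′ (s≤s z≤n)
  go (suc n) f f′ c p q p′ q′ | tri> _ _ gt =
    no-swap (suc n) e′ gt (≤-trans (below e j) q′) p′ (≤-trans (below e′ i) q)
      (reach (suc n) {α′} {α} f p q) p e (s≤s z≤n)

-- Columns are settled from left to right: `same n` is agreement in the columns before `n`, and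
-- `extends-next` adds one more.
extends-unique : ∀ {τ β α α′} → Extends τ β α → Extends τ β α′ → heights α ≡ heights α′ → α ≡ α′
extends-unique {τ} {β} {α} {α′} e e′ h =
  at-ext (pos e) (pos e′) (λ i → <-ext (λ n → proj₁ (same (suc n)) n ≤-refl i) (λ n → proj₂ (same (suc n)) n ≤-refl i))
  where
  c : ∀ n → cnt n α ≡ cnt n α′
  c n = trans (sym (at-heights α n)) (trans (cong (λ p → at p n) h) (at-heights α′ n))
  same : ∀ n → (∀ m → m < n → ∀ i → m < at α i → m < at α′ i) × (∀ m → m < n → ∀ i → m < at α′ i → m < at α i)
  same zero = (λ m ()) , (λ m ())
  same (suc n) with same n
  ... | f , f′ = g , g′
    where
    g : ∀ m → m < suc n → ∀ i → m < at α i → m < at α′ i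
    g m (s≤s le) with m≤n⇒m<n∨m≡n le
    ... | inj₁ lt   = f m lt
    ... | inj₂ refl = extends-next e e′ n (c n) f f′
    g′ : ∀ m → m < suc n → ∀ i → m < at α′ i → m < at α i
    g′ m (s≤s le) with m≤n⇒m<n∨m≡n le
    ... | inj₁ lt   = f′ m lt
    ... | inj₂ refl = extends-next e′ e n (sym (c n)) f′ f

-- For n = 0 the lengthened row is a new one on top, since at yields 0 there.
record Lengthen (n : ℕ) (α α′ : List ℕ) : Set where
  field
    row     : ℕ
    old     : at α row ≡ n
    new     : at α′ row ≡ suc n
    same    : ∀ j → j ≢ row → at α′ j ≡ at α j
    topmost : ∀ j → row < j → 0 < at α j → at α j ≢ n
    pos′    : Pos α′
    cnt-n   : cnt n α′ ≡ suc (cnt n α)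
    cnt-≢   : ∀ m → m ≢ n → cnt m α′ ≡ cnt m α

ind-suc : ∀ m n → m ≢ n → ind m (suc n) ≡ ind m n
ind-suc zero    zero    ne = ⊥-elim (ne refl)
ind-suc zero    (suc n) ne = refl
ind-suc (suc m) zero    ne = refl
ind-suc (suc m) (suc n) ne = ind-suc m n (ne ∘ cong suc)

lengthen-cons : ∀ {n α α′ a} → 0 < a → Lengthen n α α′ → Lengthen n (a ∷ α) (a ∷ α′)
lengthen-cons {n} {α} {α′} {a} pa l = record
  { row = suc row ; old = old ; new = new ; same = same′ ; topmost = topmost′ ; pos′ = pa ∷ pos′
  ; cnt-n = trans (cong (ind n a +_) cnt-n) (+-suc (ind n a) _) ; cnt-≢ = λ m ne → cong (ind m a +_) (cnt-≢ m ne) }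
  where
  open Lengthen l
  same′ : ∀ j → j ≢ suc row → at (a ∷ α′) j ≡ at (a ∷ α) j
  same′ zero    ne = refl
  same′ (suc j) ne = same j (ne ∘ cong suc)
  topmost′ : ∀ j → suc row < j → 0 < at (a ∷ α) j → at (a ∷ α) j ≢ n
  topmost′ (suc j) (s≤s lt) = topmost j lt

lengthen-head : ∀ {n α} → 0 < n → Pos α → (∀ j → at α j ≢ n) → Lengthen n (n ∷ α) (suc n ∷ α)
lengthen-head {n} {α} pn pα none = record
  { row = 0 ; old = refl ; new = refl ; same = same ; topmost = λ { (suc j) _ _ → none j } ; pos′ = s≤s z≤n ∷ pα
  ; cnt-n = cong (_+ cnt n α) (trans (ind-< {n} ≤-refl) (cong suc (sym (ind-≥ {n} ≤-refl))))
  ; cnt-≢ = λ m ne → cong (_+ cnt m α) (ind-suc m n ne) }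
  where
  same : ∀ j → j ≢ 0 → at (suc n ∷ α) j ≡ at (n ∷ α) j
  same zero    ne = ⊥-elim (ne refl)
  same (suc j) ne = refl

new-row : ∀ {α} → Pos α → ∃ (Lengthen 0 α)
new-row [] = 1 ∷ [] , record
  { row = 0 ; old = refl ; new = refl ; same = same ; topmost = λ _ _ () ; pos′ = s≤s z≤n ∷ []
  ; cnt-n = refl ; cnt-≢ = λ { zero ne → ⊥-elim (ne refl) ; (suc m) ne → refl } }
  where
  same : ∀ j → j ≢ 0 → at (1 ∷ []) j ≡ 0
  same zero    ne = ⊥-elim (ne refl)
  same (suc j) ne = refl
new-row (pa ∷ pα) with new-row pα
... | α′ , l = _ , lengthen-cons pa l

-- Higher rows are searched first, so the row found is the topmost one.
lengthen-or-none : ∀ n {α} → Pos α → ∃ (Lengthen (suc n) α) ⊎ (∀ j → at α j ≢ suc n)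
lengthen-or-none n [] = inj₂ (λ j ())
lengthen-or-none n {a ∷ α} (pa ∷ pα) with lengthen-or-none n pα
... | inj₁ (α′ , l) = inj₁ (_ , lengthen-cons pa l)
... | inj₂ none with a ≟ suc n
...   | yes refl = inj₁ (_ , lengthen-head pa pα none)
...   | no ne    = inj₂ (λ { zero → ne ; (suc j) → none j })

-- For `n = k + 1` the difference of the two counts is the number of rows of length exactly `n`, so
-- the hypothesis provides one; for `n = 0` a row can always be added on top.
lengthen : ∀ n {α} → Pos α → (∀ k → n ≡ suc k → cnt n α < cnt k α) → ∃ (Lengthen n α)
lengthen zero    pα h = new-row pα
lengthen (suc n) {α} pα h with lengthen-or-none n pα
... | inj₁ l    = l
... | inj₂ none = ⊥-elim (<⇒≱ (h n refl) (cnt-mono α α (λ i lt → ≤∧≢⇒< lt (none i ∘ sym))))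

lengthen-below : ∀ {n α α′} (l : Lengthen n α α′) → ∀ i → at α i ≤ at α′ i
lengthen-below l i with i ≟ Lengthen.row l
... | yes refl rewrite Lengthen.old l | Lengthen.new l = n≤1+n _
... | no ne    = ≤-reflexive (sym (Lengthen.same l i ne))

extends-refl : ∀ {β} τ → Pos β → Extends τ β β
extends-refl H pβ = extends pβ (λ _ → ≤-refl) (horizontal (λ i j n _ a b → ⊥-elim (<⇒≱ b a)))
extends-refl V pβ = extends pβ (λ _ → ≤-refl) (vertical (λ _ → n≤1+n _) (λ i j n _ a b → ⊥-elim (<⇒≱ b a)))

-- `within` records that nothing has been added from column `n` on. An obstruction to the new cell
-- would be a higher row of length exactly `n`, against `topmost`; every other obstruction is
-- present in `α` already.
lengthen-H : ∀ {β α α′ n} → Extends H β α → (∀ i → at α i ≡ at β i ⊎ at α i ≤ n) → Lengthen n α α′ → Extends H β α′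
lengthen-H {β} {α} {α′} {n} (extends _ le (horizontal h)) within l =
  extends pos′ (λ i → ≤-trans (le i) (lengthen-below l i)) (horizontal h′)
  where
  open Lengthen l
  h′ : ∀ i j m → i < j → at β i ≤ m → m < at α′ i → at β j ≤ m → m ≤ at α′ j → 0 < at α′ j → ⊥
  h′ i j m lt a b c d e with i ≟ row | j ≟ row
  ... | yes refl | yes refl = <-irrefl refl lt
  ... | yes refl | no ne rewrite new | same j ne with m≤n⇒m<n∨m≡n (≤-pred b)
  ...   | inj₁ m<n = h i j m lt a (subst (m <_) (sym old) m<n) c d e
  ...   | inj₂ refl with within j
  ...     | inj₁ q = topmost j lt e (≤-antisym (≤-trans (≤-reflexive q) c) d)
  ...     | inj₂ q = topmost j lt e (≤-antisym q d)
  h′ i j m lt a b c d e | no ne | yes refl rewrite same i ne with within i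
  ... | inj₁ q = <⇒≱ b (≤-trans (≤-reflexive q) a)
  ... | inj₂ q = h i j m lt a b c (subst (m ≤_) (sym old) (<⇒≤ m<n)) (subst (0 <_) (sym old) (≤-<-trans z≤n m<n))
    where
    m<n : m < n
    m<n = <-≤-trans b q
  h′ i j m lt a b c d e | no ne | no ne′ rewrite same i ne | same j ne′ = h i j m lt a b c d e

-- `fixed` records that rows shorter than `n` in `β` are untouched. Hence the chosen row has length
-- `n` in `β` and gains one cell only, and a higher row obstructing it would again contradict
-- `topmost`.
lengthen-V : ∀ {β α α′ n} → Extends V β α → (∀ i → at β i < n → at α i ≡ at β i) → Lengthen n α α′ → Extends V β α′
lengthen-V {β} {α} {α′} {n} (extends _ le (vertical s h)) fixed l =
  extends pos′ (λ i → ≤-trans (le i) (lengthen-below l i)) (vertical s′ h′)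
  where
  open Lengthen l
  β-row : at β row ≡ n
  β-row with m≤n⇒m<n∨m≡n (subst (at β row ≤_) old (le row))
  ... | inj₁ lt = ⊥-elim (<⇒≢ lt (trans (sym (fixed row lt)) old))
  ... | inj₂ e  = e
  s′ : ∀ i → at α′ i ≤ suc (at β i)
  s′ i with i ≟ row
  ... | yes refl = ≤-reflexive (trans new (cong suc (sym β-row)))
  ... | no ne    = subst (_≤ suc (at β i)) (sym (same i ne)) (s i)
  h′ : ∀ i j m → i < j → at β i ≤ m → m < at α′ i → at β j ≡ m → at α′ j ≡ m → 0 < at α′ j → ⊥
  h′ i j m lt a b c d e with i ≟ row | j ≟ row
  ... | yes refl | yes refl = <-irrefl refl lt
  ... | yes refl | no ne rewrite same j ne =
    topmost j lt e (trans d (≤-antisym (≤-pred (subst (m <_) new b)) (subst (_≤ m) β-row a)))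
  ... | no ne | yes refl = <⇒≢ (n<1+n n) (trans (sym β-row) (trans c (trans (sym d) new)))
  ... | no ne | no ne′ rewrite same i ne | same j ne′ = h i j m lt a b c d e

module _ {β p : List ℕ} (pβ : Pos β) (pp : Part p) where

  private
    N = length p

    finish : ∀ {τ α} → Extends τ β α → (∀ n → cnt n α ≡ at p n) → ∃ λ α → Extends τ β α × heights α ≡ p
    finish {α = α} e c = α , e , at-ext (heights-pos α) (proj₁ pp) (λ n → trans (at-heights α n) (c n))

  extends-exists-H : Step H (heights β) p → ∃ λ α → Extends H β α × heights α ≡ p
  extends-exists-H s = finish (Stage.ext final) complete
    where
    s₁ : ∀ n → cnt n β ≤ at p n
    s₁ n = subst (_≤ at p n) (at-heights β n) (proj₁ (s n))
    s₂ : ∀ n → at p n ≤ suc (cnt n β)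
    s₂ n = subst (λ x → at p n ≤ suc x) (at-heights β n) (proj₂ (s n))
    record Stage (n : ℕ) : Set where
      field
        α      : List ℕ
        ext    : Extends H β α
        within : ∀ i → at α i ≡ at β i ⊎ at α i ≤ n
        done   : ∀ m → m < n → cnt m α ≡ at p m
        todo   : ∀ m → n ≤ m → cnt m α ≡ cnt m β
    stage : ∀ n → Stage n
    stage zero = record
      { α = β ; ext = extends-refl H pβ ; within = λ _ → inj₁ refl ; done = λ m () ; todo = λ _ _ → refl }
    stage (suc n) with stage n | m≤n⇒m<n∨m≡n (s₁ n)
    ... | S | inj₂ e = record
      { α = α ; ext = ext
      ; within = λ i → [ inj₁ , inj₂ ∘ m≤n⇒m≤1+n ]′ (within i)
      ; done = done′
      ; todo = λ m le → todo m (<⇒≤ le) }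
      where
      open Stage S
      done′ : ∀ m → m < suc n → cnt m α ≡ at p m
      done′ m (s≤s le) with m≤n⇒m<n∨m≡n le
      ... | inj₁ lt   = done m lt
      ... | inj₂ refl = trans (todo n ≤-refl) e
    ... | S | inj₁ lt with lengthen n (pos (Stage.ext S)) room
      where
      open Stage S
      -- Column `k` already has its final height `at p k`, which is at least `at p n` and so exceeds
      -- the present height of column `n`.
      room : ∀ k → n ≡ suc k → cnt n α < cnt k α
      room k refl rewrite todo n ≤-refl | done k ≤-refl = <-≤-trans lt (proj₂ pp k)
    ...   | α′ , l = record
      { α = α′ ; ext = lengthen-H ext within l ; within = within′ ; done = done′
      ; todo = λ m le → trans (Lengthen.cnt-≢ l m (>⇒≢ le)) (todo m (<⇒≤ le)) }
      where
      open Stage S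
      within′ : ∀ i → at α′ i ≡ at β i ⊎ at α′ i ≤ suc n
      within′ i with i ≟ Lengthen.row l
      ... | yes refl = inj₂ (≤-reflexive (Lengthen.new l))
      ... | no ne rewrite Lengthen.same l i ne = [ inj₁ , inj₂ ∘ m≤n⇒m≤1+n ]′ (within i)
      done′ : ∀ m → m < suc n → cnt m α′ ≡ at p m
      done′ m (s≤s le) with m≤n⇒m<n∨m≡n le
      ... | inj₁ lt′  = trans (Lengthen.cnt-≢ l m (<⇒≢ lt′)) (done m lt′)
      ... | inj₂ refl = trans (Lengthen.cnt-n l) (trans (cong suc (todo n ≤-refl)) (≤-antisym lt (s₂ n)))
    final = stage N
    complete : ∀ n → cnt n (Stage.α final) ≡ at p n
    complete n with n <? N
    ... | yes lt = Stage.done final n lt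
    ... | no nlt = trans (Stage.todo final n (≮⇒≥ nlt)) (≤-antisym (s₁ n) (≤-trans (≤-reflexive (at-beyond p (≮⇒≥ nlt))) z≤n))

  extends-exists-V : Step V (heights β) p → ∃ λ α → Extends V β α × heights α ≡ p
  extends-exists-V s = loop N (at p N ∸ cnt N β) record
    { α = β ; ext = extends-refl V pβ ; fixed = λ _ _ → refl ; done = λ m lt → beyond m (<⇒≤ lt)
    ; todo = λ _ _ → refl ; left = m+[n∸m]≡n (s₁ N) }
    where
    s₁ : ∀ n → cnt n β ≤ at p n
    s₁ n = subst (_≤ at p n) (at-heights β n) (proj₁ (s n))
    s₂ : ∀ n → at p (suc n) ≤ cnt n β
    s₂ n = subst (at p (suc n) ≤_) (at-heights β n) (proj₂ (s n))
    beyond : ∀ m → N ≤ m → cnt m β ≡ at p m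
    beyond m le = ≤-antisym (s₁ m) (≤-trans (≤-reflexive (at-beyond p le)) z≤n)
    record Stage (n k : ℕ) : Set where
      field
        -- At this stage `k` cells are still to be added in column `n`; the columns to its right are
        -- final and those to its left are unchanged.
        α     : List ℕ
        ext   : Extends V β α
        fixed : ∀ i → at β i < n → at α i ≡ at β i
        done  : ∀ m → n < m → cnt m α ≡ at p m
        todo  : ∀ m → m < n → cnt m α ≡ cnt m β
        left  : cnt n α + k ≡ at p n
    next : ∀ {n} → Stage (suc n) 0 → Stage n (at p n ∸ cnt n β)
    next {n} S = record
      { α = α ; ext = ext ; fixed = λ i lt → fixed i (m≤n⇒m≤1+n lt) ; done = done′
      ; todo = λ m lt → todo m (m≤n⇒m≤1+n lt)
      ; left = trans (cong (_+ (at p n ∸ cnt n β)) (todo n ≤-refl)) (m+[n∸m]≡n (s₁ n)) }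
      where
      open Stage S
      done′ : ∀ m → n < m → cnt m α ≡ at p m
      done′ m le with m≤n⇒m<n∨m≡n le
      ... | inj₁ lt   = done m lt
      ... | inj₂ refl = trans (sym (+-identityʳ _)) left
    fill : ∀ {n k} → Stage n (suc k) → Stage n k
    fill {n} {k} S with lengthen n (pos (Stage.ext S)) room
      where
      open Stage S
      -- The column to the left still has its height in `β`, which the strip condition makes at
      -- least `at p n`.
      room : ∀ i → n ≡ suc i → cnt n α < cnt i α
      room i refl rewrite todo i ≤-refl =
        <-≤-trans (m<m+n (cnt n α) (s≤s (z≤n {k}))) (≤-trans (≤-reflexive left) (s₂ i))
    ... | α′ , l = record
      { α = α′ ; ext = lengthen-V ext fixed l ; fixed = fixed′
      ; done = λ m lt → trans (Lengthen.cnt-≢ l m (>⇒≢ lt)) (done m lt)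
      ; todo = λ m lt → trans (Lengthen.cnt-≢ l m (<⇒≢ lt)) (todo m lt)
      ; left = trans (cong (_+ k) (Lengthen.cnt-n l)) (trans (sym (+-suc _ k)) left) }
      where
      open Stage S
      fixed′ : ∀ i → at β i < n → at α′ i ≡ at β i
      fixed′ i lt = trans (Lengthen.same l i (λ { refl → <⇒≢ lt (trans (sym (fixed i lt)) (Lengthen.old l)) })) (fixed i lt)
    loop : ∀ n k → Stage n k → ∃ λ α → Extends V β α × heights α ≡ p
    loop n       (suc k) S = loop n k (fill S)
    loop (suc n) zero    S = loop n _ (next S)
    loop zero    zero    S = finish (Stage.ext S)
      (λ { zero → trans (sym (+-identityʳ _)) (Stage.left S) ; (suc m) → Stage.done S (suc m) (s≤s z≤n) })

  extends-exists : ∀ τ → Step τ (heights β) p → ∃ λ α → Extends τ β α × heights α ≡ p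
  extends-exists H = extends-exists-H
  extends-exists V = extends-exists-V

-- Adding one letter to a hook composition tableau

tag : ∀ {k l} → Letter k l → Tag
tag (inj₁ _) = H
tag (inj₂ _) = V

module _ {k l : ℕ} where

  <ᴸ-trans : {x y z : Letter k l} → x <ᴸ y → y <ᴸ z → x <ᴸ z
  <ᴸ-trans (u<u p) (u<u q) = u<u (Fin.<-trans p q)
  <ᴸ-trans (u<u p) u<p     = u<p
  <ᴸ-trans u<p     (p<p q) = u<p
  <ᴸ-trans (p<p p) (p<p q) = p<p (Fin.<-trans p q)

  <ᴸ-irrefl : {x : Letter k l} → ¬ x <ᴸ x
  <ᴸ-irrefl (u<u p) = <-irrefl refl p
  <ᴸ-irrefl (p<p p) = <-irrefl refl p

  shape-pos : {F : Filling k l} → All (λ row → 0 < length row) F → Pos (shape F)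
  shape-pos = map⁺

  nth-length : ∀ {A : Set} (r : List A) n {y} → nth r n ≡ just y → n < length r
  nth-length (z ∷ r) zero    e = s≤s z≤n
  nth-length (z ∷ r) (suc n) e = s≤s (nth-length r n e)

  cell-length : ∀ (F : Filling k l) i n {y} → cell F i n ≡ just y → i < length F
  cell-length (r ∷ F) zero    n e = s≤s z≤n
  cell-length (r ∷ F) (suc i) n e = s≤s (cell-length F i n e)

  cell-max : ∀ (F : Filling k l) i n {y} → cell F i n ≡ just y → n < maxPart (shape F)
  cell-max (r ∷ F) zero    n e = <-≤-trans (nth-length r n e) (m≤m⊔n _ _)
  cell-max (r ∷ F) (suc i) n e = <-≤-trans (cell-max F i n e) (m≤n⊔m (length r) _)

  data Adjoin (x : Letter k l) : Filling k l → Filling k l → Set where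
    []  : Adjoin x [] []
    new : ∀ {F} m → Adjoin x [] F → Adjoin x [] (replicate m x ∷ F)
    old : ∀ {F′ F} r m → Adjoin x F′ F → Adjoin x (r ∷ F′) ((r ++ replicate m x) ∷ F)

  -- `c′` and `c` are the same cell before and after adjoining `x`; `b` and `a` are the lengths of
  -- its row.
  data View (x : Letter k l) (c′ c : Ext k l) (b a n : ℕ) : Set where
    kept    : ∀ {y} → c′ ≡ just y → c ≡ just y → n < b → n < a → View x c′ c b a n
    added   : c′ ≡ nothing → c ≡ just x → b ≤ n → n < a → View x c′ c b a n
    outside : c′ ≡ nothing → c ≡ nothing → b ≤ n → a ≤ n → View x c′ c b a n

  view-row : ∀ x r m n → View x (nth r n) (nth (r ++ replicate m x) n) (length r) (length (r ++ replicate m x)) n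
  view-row x []      zero    n       = outside refl refl z≤n z≤n
  view-row x []      (suc m) zero    = added refl refl z≤n (s≤s z≤n)
  view-row x []      (suc m) (suc n) with view-row x [] m n
  ... | added _ e _ q   = added refl e z≤n (s≤s q)
  ... | outside _ e _ q = outside refl e z≤n (s≤s q)
  view-row x (y ∷ r) m zero = kept refl refl (s≤s z≤n) (s≤s z≤n)
  view-row x (y ∷ r) m (suc n) with view-row x r m n
  ... | kept e e′ p q    = kept e e′ (s≤s p) (s≤s q)
  ... | added e e′ p q   = added e e′ (s≤s p) (s≤s q)
  ... | outside e e′ p q = outside e e′ (s≤s p) (s≤s q)

  view : ∀ {x F′ F} → Adjoin x F′ F → ∀ i n → View x (cell F′ i n) (cell F i n) (at (shape F′) i) (at (shape F) i) n
  view []                  i       n = outside refl refl z≤n z≤n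
  view {x} (new m ad)      zero    n = view-row x [] m n
  view     (new m ad)      (suc i) n = view ad i n
  view {x} (old r m ad)    zero    n = view-row x r m n
  view     (old r m ad)    (suc i) n = view ad i n

  Below : Letter k l → Filling k l → Set
  Below x F = ∀ i n y → cell F i n ≡ just y → y <ᴸ x

  -- A cell bounded by a letter smaller than `x` is neither new nor missing.
  kept-≤ : ∀ {x c′ c b a n z} → View x c′ c b a n → c ≤ᴱ just z → z <ᴸ x → c′ ≡ c × ∃ λ y → c′ ≡ just y
  kept-≤ (kept e e′ _ _)       le              lt = trans e (sym e′) , _ , e
  kept-≤ (added _ refl _ _)    (inj₁ (fin le)) lt = ⊥-elim (<ᴸ-irrefl (<ᴸ-trans le lt))
  kept-≤ (added _ refl _ _)    (inj₂ refl)     lt = ⊥-elim (<ᴸ-irrefl lt)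
  kept-≤ (outside _ refl _ _)  (inj₁ ())       lt
  kept-≤ (outside _ refl _ _)  (inj₂ ())       lt

  kept-fin : ∀ {x c′ c b a n z} → View x c′ c b a n → c′ ≤ᴱ just z → c ≡ c′
  kept-fin (kept e e′ _ _)       le        = trans e′ (sym e)
  kept-fin (added refl _ _ _)    (inj₁ ())
  kept-fin (added refl _ _ _)    (inj₂ ())
  kept-fin (outside refl _ _ _)  (inj₁ ())
  kept-fin (outside refl _ _ _)  (inj₂ ())

  reached : ∀ {x c′ c b a n z} → View x c′ c b a n → c ≤ᴱ just z → n < a
  reached (kept _ _ _ q)        le = q
  reached (added _ _ _ q)       le = q
  reached (outside _ refl _ _)  le = ⊥-elim ([ (λ ()) , (λ ()) ]′ le)

  kept-< : ∀ {x c′ c b a n} → View x c′ c b a n → c <ᴱ just x → n < b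
  kept-< (kept _ _ p _)        lt       = p
  kept-< (added _ refl _ _)    (fin lt) = ⊥-elim (<ᴸ-irrefl lt)
  kept-< (outside _ refl _ _)  ()

  ≤ᴱ-finite : ∀ {c : Ext k l} {z} → c ≤ᴱ just z → ∃ λ y → c ≡ just y
  ≤ᴱ-finite (inj₁ (fin _)) = _ , refl
  ≤ᴱ-finite (inj₂ refl)    = _ , refl

  twice-in-row : ∀ {β α} x → Extends (tag x) β α → ∀ i {n} → at β i ≤ n → suc n < at α i → Unprimed {k} {l} (just x)
  twice-in-row (inj₁ _) e i p q = unp
  twice-in-row (inj₂ _) (extends _ _ (vertical s _)) i p q = ⊥-elim (<⇒≱ q (≤-trans (s i) (s≤s p)))

  twice-in-first-column : ∀ {β α} x → Extends (tag x) β α → ∀ i → at β i ≤ 0 → 0 < at α i →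
    at β (suc i) ≤ 0 → 0 < at α (suc i) → Primed {k} {l} (just x)
  twice-in-first-column (inj₁ _) (extends _ _ (horizontal h)) i a b c d = ⊥-elim (h i (suc i) 0 (n<1+n i) a b c z≤n d)
  twice-in-first-column (inj₂ _) e i a b c d = pr

  clash-H : ∀ {β α} x → Unprimed {k} {l} (just x) → Extends (tag x) β α → ∀ {i j n} → i < j →
    at β i ≤ suc n → suc n < at α i → at β j ≤ suc n → suc n ≤ at α j → ⊥
  clash-H (inj₁ _) unp (extends _ _ (horizontal h)) lt p q p′ q′ = h _ _ _ lt p q p′ q′ (≤-trans (s≤s z≤n) q′)

  clash-V : ∀ {β α} x → Primed {k} {l} (just x) → Extends (tag x) β α → ∀ {i j n} → i < j →
    at β i ≤ suc n → suc n < at α i → at β j ≡ suc n → at α j ≡ suc n → ⊥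
  clash-V (inj₂ _) pr (extends _ _ (vertical _ h)) lt p q p′ q′ = h _ _ _ lt p q p′ q′ (subst (0 <_) (sym q′) (s≤s z≤n))

  <ᴱ-just : ∀ {x y : Letter k l} → just x <ᴱ just y → x <ᴸ y
  <ᴱ-just (fin p) = p

  module _ {x : Letter k l} {F′ F : Filling k l} (ad : Adjoin x F′ F) (below : Below x F′) where

    open IsHCT

    private
      β = shape F′
      α = shape F

    -- If cell `(i, n + 1)` of a triple is old, so is the cell compared with it in the premise, and
    -- the triple condition of `F′` applies. If it holds `x`, `Unobstructed` rules out a violation.
    adjoin-HCT : IsHCT F′ → Extends (tag x) β α → IsHCT F
    adjoin-HCT t ext = record
      { composition = map⁻ (Extends.pos ext)
      ; rows = rows′ ; firstColumn = firstColumn′ ; tripleA = tripleA′ ; tripleB = tripleB′ }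
      where
      β-pos = shape-pos (composition t)
      rows′ : ∀ i n y z → cell F i n ≡ just y → cell F i (suc n) ≡ just z → y <ᴸ z ⊎ (y ≡ z × Unprimed (just y))
      rows′ i n y z ey ez with view ad i n | view ad i (suc n)
      ... | kept e′ e p q      | kept d′ d _ _    = rows t i n y z (trans e′ (trans (sym e) ey)) (trans d′ (trans (sym d) ez))
      ... | kept e′ e p q      | added d′ d _ _   with refl ← trans (sym d) ez = inj₁ (below i n y (trans e′ (trans (sym e) ey)))
      ... | added e′ e p q     | kept d′ d p′ _   = ⊥-elim (<⇒≱ p′ (m≤n⇒m≤1+n p))
      ... | added e′ e p q     | added d′ d _ q′  with refl ← trans (sym e) ey | refl ← trans (sym d) ez =
        inj₂ (refl , twice-in-row x ext i p q′)
      ... | outside _ e _ _    | _                with () ← trans (sym e) ey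
      ... | _                  | outside _ d _ _  with () ← trans (sym d) ez
      firstColumn′ : ∀ i y z → cell F i 0 ≡ just y → cell F (suc i) 0 ≡ just z → y <ᴸ z ⊎ (y ≡ z × Primed (just y))
      firstColumn′ i y z ey ez with view ad i 0 | view ad (suc i) 0
      ... | kept e′ e p q      | kept d′ d _ _    = firstColumn t i y z (trans e′ (trans (sym e) ey)) (trans d′ (trans (sym d) ez))
      ... | kept e′ e p q      | added d′ d _ _   with refl ← trans (sym d) ez = inj₁ (below i 0 y (trans e′ (trans (sym e) ey)))
      ... | added e′ e p q     | kept d′ d p′ _   = ⊥-elim (<⇒≱ (pos-down β-pos i (suc i) (n≤1+n i) p′) p)
      ... | added e′ e p q     | added d′ d p′ q′ with refl ← trans (sym e) ey | refl ← trans (sym d) ez =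
        inj₂ (refl , twice-in-first-column x ext i p q p′ q′)
      ... | outside _ e _ _    | _                with () ← trans (sym e) ey
      ... | _                  | outside _ d _ _  with () ← trans (sym d) ez
      tripleA′ : ∀ i j n → i < j → j < length F → suc n < maxPart α → Unprimed (cell F i (suc n)) →
                 cell F j n ≤ᴱ cell F i (suc n) → cell F j (suc n) <ᴱ cell F i (suc n)
      tripleA′ i j n lt jF _ un le with view ad i (suc n)
      ... | outside _ e _ _ rewrite e with () ← un
      ... | kept {z} e′ e _ _ rewrite e with kept-≤ (view ad j n) le (below i (suc n) z e′)
      ...   | same , w , ew =
        subst (_<ᴱ just z) (sym (kept-fin (view ad j (suc n)) (inj₁ old<))) old<
        where
        old< : cell F′ j (suc n) <ᴱ just z
        old< = subst (cell F′ j (suc n) <ᴱ_) e′ (tripleA t i j n lt (cell-length F′ j n ew) (cell-max F′ i (suc n) e′)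
          (subst Unprimed (sym e′) un) (subst₂ _≤ᴱ_ (sym same) (sym e′) le))
      tripleA′ i j n lt jF _ un le | added e′ e p q rewrite e with view ad j (suc n)
      ... | kept {w} d′ d _ _ rewrite d = fin (below j (suc n) w d′)
      ... | added _ _ p′ _   = ⊥-elim (clash-H x un ext lt p q p′ (reached (view ad j n) le))
      ... | outside _ _ p′ _ = ⊥-elim (clash-H x un ext lt p q p′ (reached (view ad j n) le))
      tripleB′ : ∀ i j n → i < j → j < length F → suc n < maxPart α → Primed (cell F i (suc n)) →
                 cell F j n <ᴱ cell F i (suc n) → cell F j (suc n) ≤ᴱ cell F i (suc n)
      tripleB′ i j n lt jF _ un le with view ad i (suc n)
      ... | outside _ e _ _ rewrite e with () ← un
      ... | kept {z} e′ e _ _ rewrite e with kept-≤ (view ad j n) (inj₁ le) (below i (suc n) z e′)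
      ...   | same , w , ew =
        subst (_≤ᴱ just z) (sym (kept-fin (view ad j (suc n)) old≤)) old≤
        where
        old≤ : cell F′ j (suc n) ≤ᴱ just z
        old≤ = subst (cell F′ j (suc n) ≤ᴱ_) e′ (tripleB t i j n lt (cell-length F′ j n ew) (cell-max F′ i (suc n) e′)
          (subst Primed (sym e′) un) (subst₂ _<ᴱ_ (sym same) (sym e′) le))
      tripleB′ i j n lt jF _ un le | added e′ e p q rewrite e with view ad j (suc n)
      ... | kept {w} d′ d _ _ rewrite d = inj₁ (fin (below j (suc n) w d′))
      ... | added _ d p′ q′ = inj₂ d
      -- Row `j` has no cell in column `n + 1`, while its cell in column `n` is smaller than `x` and
      -- hence old. So the row has length `n + 1` before and after.
      ... | outside _ d p′ q′ with view ad j n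
      ...   | outside _ _ _ a = ⊥-elim (<⇒≱ (reached (view ad j n) (inj₁ le)) a)
      ...   | added _ f _ _   = ⊥-elim (<ᴸ-irrefl (<ᴱ-just (subst (_<ᴱ just x) f le)))
      ...   | kept _ _ b a    = ⊥-elim (clash-V x un ext lt p q (≤-antisym p′ b) (≤-antisym q′ a))

    module _ (t : IsHCT F) (β-pos : Pos β) where

      private
        α-pos : Pos α
        α-pos = shape-pos (composition t)

        carry : ∀ {i n y} → cell F′ i n ≡ just y → cell F i n ≡ just y
        carry {i} {n} e with view ad i n
        ... | kept e′ d _ _    = trans d (trans (sym e′) e)
        ... | added e′ _ _ _   with () ← trans (sym e′) e
        carry e | outside e′ _ _ _ with () ← trans (sym e′) e

        new-cell : ∀ {i n} → at β i ≤ n → n < at α i → cell F i n ≡ just x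
        new-cell {i} {n} p q with view ad i n
        ... | kept _ _ p′ _     = ⊥-elim (<⇒≱ p′ p)
        ... | added _ e _ _     = e
        ... | outside _ _ _ q′  = ⊥-elim (<⇒≱ q q′)

        cell≤x : ∀ {i n} → n < at α i → cell F i n ≤ᴱ just x
        cell≤x {i} {n} q with view ad i n
        ... | kept e′ e _ _     rewrite e = inj₁ (fin (below i n _ e′))
        ... | added _ e _ _     = inj₂ e
        ... | outside _ _ _ q′  = ⊥-elim (<⇒≱ q q′)

        kept-cell : ∀ {i n} → n < at β i → ∃ λ y → cell F i n ≡ just y × y <ᴸ x
        kept-cell {i} {n} q with view ad i n
        ... | kept e′ e _ _     = _ , e , below i n _ e′
        ... | added _ _ p _     = ⊥-elim (<⇒≱ q p)
        ... | outside _ _ p _   = ⊥-elim (<⇒≱ q p)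

        α-row : ∀ {i} n → n < at α i → i < length F
        α-row {i} n q with cell≤x {i} {n} q
        ... | le with cell F i n in e
        ...   | just y = cell-length F i n e
        ...   | nothing = ⊥-elim ([ (λ ()) , (λ ()) ]′ le)

      -- Cells of `F′` are unchanged in `F`, so premises carry over; each conclusion bounds a cell
      -- by an old letter, which makes that cell old too.
      restrict-HCT : IsHCT F′
      restrict-HCT = record
        { composition = map⁻ β-pos
        ; rows = λ i n y z e d → rows t i n y z (carry e) (carry d)
        ; firstColumn = λ i y z e d → firstColumn t i y z (carry e) (carry d)
        ; tripleA = tripleA′ ; tripleB = tripleB′ }
        where
        tripleA′ : ∀ i j n → i < j → j < length F′ → suc n < maxPart β → Unprimed (cell F′ i (suc n)) →
                   cell F′ j n ≤ᴱ cell F′ i (suc n) → cell F′ j (suc n) <ᴱ cell F′ i (suc n)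
        tripleA′ i j n lt _ _ un le with cell F′ i (suc n) in e
        ... | just z with subst (cell F j (suc n) <ᴱ_) (carry e) (tripleA t i j n lt
                (cell-length F j n (trans (kept-fin (view ad j n) le) (proj₂ (≤ᴱ-finite le))))
                (cell-max F i (suc n) (carry e)) (subst Unprimed (sym (carry e)) un)
                (subst₂ _≤ᴱ_ (sym (kept-fin (view ad j n) le)) (sym (carry e)) le))
        ...   | r = subst (_<ᴱ just z) (sym (proj₁ (kept-≤ (view ad j (suc n)) (inj₁ r) (below i (suc n) z e)))) r
        tripleB′ : ∀ i j n → i < j → j < length F′ → suc n < maxPart β → Primed (cell F′ i (suc n)) →
                   cell F′ j n <ᴱ cell F′ i (suc n) → cell F′ j (suc n) ≤ᴱ cell F′ i (suc n)
        tripleB′ i j n lt _ _ un le with cell F′ i (suc n) in e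
        ... | just z with subst (cell F j (suc n) ≤ᴱ_) (carry e) (tripleB t i j n lt
                (cell-length F j n (trans (kept-fin (view ad j n) (inj₁ le)) (proj₂ (≤ᴱ-finite (inj₁ le)))))
                (cell-max F i (suc n) (carry e)) (subst Primed (sym (carry e)) un)
                (subst₂ _<ᴱ_ (sym (kept-fin (view ad j n) (inj₁ le))) (sym (carry e)) le))
        ...   | r = subst (_≤ᴱ just z) (sym (proj₁ (kept-≤ (view ad j (suc n)) r (below i (suc n) z e)))) r

      private
        below-α : ∀ i → at β i ≤ at α i
        below-α i with at β i ≤? at α i
        ... | yes p = p
        ... | no q with view ad i (at α i)
        ...   | kept _ _ _ a    = ⊥-elim (<-irrefl refl a)
        ...   | added _ _ b a   = ⊥-elim (<-irrefl refl a)
        ...   | outside _ _ b a = ⊥-elim (q b)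

        new-below : ∀ {i n} → i ≤ n → at β i ≤ 0 → at β n ≤ 0
        new-below {i} {n} le p with 0 <? at β n
        ... | yes q = ⊥-elim (<⇒≱ (pos-down β-pos i n le q) p)
        ... | no q  = ≮⇒≥ q

      -- For a cell holding `x` the tableau conditions become `Unobstructed`: strictness in the
      -- first column or along rows, and (a) or (b) in the later columns.
      restrict-extends : Extends (tag x) β α
      restrict-extends = extends α-pos below-α (unobstructed x refl)
        where
        unobstructed : ∀ y → y ≡ x → Unobstructed β α (tag y)
        unobstructed (inj₁ u) refl = horizontal h
          where
          h : ∀ i j n → i < j → at β i ≤ n → n < at α i → at β j ≤ n → n ≤ at α j → 0 < at α j → ⊥
          -- Rows above a new row are new as well, so row `i + 1` starts with `x` just as row `i`
          -- does, against strictness in the first column.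
          h i j zero lt a b c d 0<
            with firstColumn t i x x (new-cell a b)
                   (new-cell (new-below (n≤1+n i) a) (pos-down α-pos (suc i) j lt 0<))
          ... | inj₁ p = <ᴸ-irrefl p
          ... | inj₂ (_ , ())
          h i j (suc n) lt a b c d _ with tripleA t i j n lt (α-row n d) (cell-max F i (suc n) xi)
                (subst Unprimed (sym xi) unp) (subst (cell F j n ≤ᴱ_) (sym xi) (cell≤x d))
            where
            xi = new-cell a b
          ... | r = <⇒≱ (kept-< (view ad j (suc n)) (subst (cell F j (suc n) <ᴱ_) (new-cell a b) r)) c
        unobstructed (inj₂ u) refl = vertical s h
          where
          s : ∀ i → at α i ≤ suc (at β i)
          s i with at α i ≤? suc (at β i)
          ... | yes p = p
          ... | no q with rows t i (at β i) x x (new-cell ≤-refl (<-trans (n<1+n _) (≰⇒> q))) (new-cell (n≤1+n _) (≰⇒> q))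
          ...   | inj₁ p = ⊥-elim (<ᴸ-irrefl p)
          ...   | inj₂ (_ , ())
          h : ∀ i j n → i < j → at β i ≤ n → n < at α i → at β j ≡ n → at α j ≡ n → 0 < at α j → ⊥
          h i j zero lt a b c d 0< = <⇒≢ 0< (sym d)
          h i j (suc n) lt a b c d 0< with kept-cell {j} {n} (≤-reflexive (sym c))
          ... | y , ey , y<x = <⇒≱ (reached (view ad j (suc n))
              (subst (cell F j (suc n) ≤ᴱ_) xi (tripleB t i j n lt (cell-length F j n ey) (cell-max F i (suc n) xi)
                (subst Primed (sym xi) pr) (subst₂ _<ᴱ_ (sym ey) (sym xi) (fin y<x)))))
              (≤-reflexive d)
            where
            xi = new-cell {i} a b

-- Tableaux as chains of partitions

nth-ext : ∀ {A : Set} (r s : List A) → (∀ n → nth r n ≡ nth s n) → r ≡ s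
nth-ext []      []      e = refl
nth-ext []      (y ∷ s) e with () ← e 0
nth-ext (x ∷ r) []      e with () ← e 0
nth-ext (x ∷ r) (y ∷ s) e = cong₂ _∷_ (just-injective (e 0)) (nth-ext r s (e ∘ suc))

module _ {k l : ℕ} where

  cell-ext : ∀ {F G : Filling k l} → Pos (shape F) → Pos (shape G) → (∀ i n → cell F i n ≡ cell G i n) → F ≡ G
  cell-ext {[]}          {[]}          pF        pG        e = refl
  cell-ext {[]}          {(y ∷ s) ∷ G} pF        pG        e with () ← e 0 0
  cell-ext {(y ∷ r) ∷ F} {[]}          pF        pG        e with () ← e 0 0
  cell-ext {[]}          {[] ∷ G}      pF        (() ∷ _) e
  cell-ext {[] ∷ F}      {[]}          (() ∷ _) pG        e
  cell-ext {r ∷ F}       {s ∷ G}       (_ ∷ pF) (_ ∷ pG) e =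
    cong₂ _∷_ (nth-ext r s (e 0)) (cell-ext pF pG (e ∘ suc))

  adjoin-unique : ∀ {x} {F′ F G : Filling k l} → Pos (shape F) → Adjoin x F′ F → Adjoin x F′ G →
                  shape F ≡ shape G → F ≡ G
  adjoin-unique {F′ = F′} {F} {G} pF aF aG e = cell-ext pF (subst Pos e pF) same
    where
    same : ∀ i n → cell F i n ≡ cell G i n
    same i n with view aF i n | subst (λ α → View _ (cell F′ i n) (cell G i n) _ (at α i) n) (sym e) (view aG i n)
    ... | kept a b _ _    | kept c d _ _    = trans b (trans (sym a) (trans c (sym d)))
    ... | added a b _ _   | added c d _ _   = trans b (sym d)
    ... | outside a b _ _ | outside c d _ _ = trans b (sym d)
    ... | kept a _ _ _    | added c _ _ _   with () ← trans (sym a) c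
    ... | kept a _ _ _    | outside c _ _ _ with () ← trans (sym a) c
    same i n | added a _ _ _   | kept c _ _ _    with () ← trans (sym a) c
    same i n | added _ _ _ a   | outside _ _ _ b = ⊥-elim (<⇒≱ a b)
    same i n | outside a _ _ _ | kept c _ _ _    with () ← trans (sym a) c
    same i n | outside _ _ _ b | added _ _ _ a   = ⊥-elim (<⇒≱ a b)

  -- The old cells of `F` are exactly those that do not hold `x`.
  restrict-unique : ∀ {x} {F′ F″ F : Filling k l} → Pos (shape F′) → Pos (shape F″) → Below x F′ → Below x F″ →
                    Adjoin x F′ F → Adjoin x F″ F → F′ ≡ F″
  restrict-unique {x} {F′} {F″} {F} p′ p″ b′ b″ a′ a″ = cell-ext p′ p″ same
    where
    not-x : ∀ {y} → y <ᴸ x → just y ≢ just x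
    not-x lt refl = <ᴸ-irrefl lt
    same : ∀ i n → cell F′ i n ≡ cell F″ i n
    same i n with view a′ i n | view a″ i n
    ... | kept a b _ _    | kept c d _ _    = trans a (trans (sym b) (trans d (sym c)))
    ... | added a _ _ _   | added c _ _ _   = trans a (sym c)
    ... | added a _ _ _   | outside c _ _ _ = trans a (sym c)
    ... | outside a _ _ _ | added c _ _ _   = trans a (sym c)
    ... | outside a _ _ _ | outside c _ _ _ = trans a (sym c)
    ... | kept a b _ _    | added _ d _ _   = ⊥-elim (not-x (b′ i n _ a) (trans (sym b) d))
    ... | added _ d _ _   | kept a b _ _    = ⊥-elim (not-x (b″ i n _ a) (trans (sym b) d))
    ... | kept _ b _ _    | outside _ d _ _ with () ← trans (sym b) d
    same i n | outside _ d _ _ | kept _ b _ _ with () ← trans (sym b) d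

  adjoin-exists : ∀ x (F′ : Filling k l) {α} → Pos (shape F′) → (∀ i → at (shape F′) i ≤ at α i) →
                  ∃ λ F → Adjoin x F′ F × shape F ≡ α
  adjoin-exists x []       {[]}    _ le = [] , [] , refl
  adjoin-exists x []       {a ∷ α} _ le with adjoin-exists x [] {α} [] (λ _ → z≤n)
  ... | F , ad , e = _ , new a ad , cong₂ _∷_ (length-replicate a) e
  adjoin-exists x (r ∷ F′) {[]}    (p ∷ _) le = ⊥-elim (<⇒≱ p (le 0))
  adjoin-exists x (r ∷ F′) {a ∷ α} (_ ∷ ps) le with adjoin-exists x F′ {α} ps (le ∘ suc)
  ... | F , ad , e = _ , old r (a ∸ length r) ad , cong₂ _∷_
    (trans (length-++ r) (trans (cong (length r +_) (length-replicate (a ∸ length r))) (m+[n∸m]≡n (le 0)))) e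

  countRow-≢ : ∀ c {x} r m → c ≢ x → countRow {k} {l} c (r ++ replicate m x) ≡ countRow c r
  countRow-≢ c     []      zero    ne = refl
  countRow-≢ c {x} []      (suc m) ne with ≡-dec Fin._≟_ Fin._≟_ x c
  ... | yes e = ⊥-elim (ne (sym e))
  ... | no _  = countRow-≢ c [] m ne
  countRow-≢ c     (y ∷ r) m       ne with ≡-dec Fin._≟_ Fin._≟_ y c
  ... | yes _ = cong suc (countRow-≢ c r m ne)
  ... | no _  = countRow-≢ c r m ne

  countRow-new : ∀ x r m → (∀ n y → nth r n ≡ just y → y <ᴸ x) → countRow {k} {l} x (r ++ replicate m x) ≡ m
  countRow-new x []      zero    lt = refl
  countRow-new x []      (suc m) lt with ≡-dec Fin._≟_ Fin._≟_ x x
  ... | yes _ = cong suc (countRow-new x [] m lt)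
  ... | no ne = ⊥-elim (ne refl)
  countRow-new x (y ∷ r) m       lt with ≡-dec Fin._≟_ Fin._≟_ y x
  ... | yes e = ⊥-elim (<ᴸ-irrefl (subst (_<ᴸ x) e (lt 0 y refl)))
  ... | no _  = countRow-new x r m (λ n → lt (suc n))

  count-other : ∀ {x c} {F′ F : Filling k l} → c ≢ x → Adjoin x F′ F → count c F ≡ count c F′
  count-other         ne []           = refl
  count-other {c = c} ne (new m ad)   = cong₂ _+_ (countRow-≢ c [] m ne) (count-other ne ad)
  count-other {c = c} ne (old r m ad) = cong₂ _+_ (countRow-≢ c r m ne) (count-other ne ad)

  count-added : ∀ {x} {F′ F : Filling k l} → Below x F′ → Adjoin x F′ F → sum (shape F) ≡ sum (shape F′) + count x F
  count-added     b []           = refl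
  count-added {x} b (new m ad)   = cong₂ _+_
    (trans (length-replicate m) (sym (countRow-new x [] m (λ n y ())))) (count-added b ad)
  count-added {x} b (old {F′} {F} r m ad) = begin
    length (r ++ replicate m x) + sum (shape F)
      ≡⟨ cong₂ _+_ (trans (length-++ r) (cong (length r +_) (length-replicate m))) (count-added (b ∘ suc) ad) ⟩
    length r + m + (sum (shape F′) + count x F)
      ≡⟨ cong (λ c → length r + c + (sum (shape F′) + count x F)) (countRow-new x r m (b 0)) ⟨
    length r + countRow x (r ++ replicate m x) + (sum (shape F′) + count x F)
      ≡⟨ lem (length r) _ (sum (shape F′)) (count x F) ⟩
    length r + sum (shape F′) + (countRow x (r ++ replicate m x) + count x F) ∎
    where
    open ≡-Reasoning
    lem : ∀ a b c d → a + b + (c + d) ≡ a + c + (b + d)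
    lem = solve-∀

  -- Removing the largest letter from a filling

  module _ {x : Letter k l} {P : Letter k l → Set} (P< : ∀ {y} → P y → y <ᴸ x) where

    after-x : ∀ {y z} → y ≡ x → z ≡ x ⊎ P z → y <ᴸ z ⊎ y ≡ z → z ≡ x
    after-x refl (inj₁ e) _         = e
    after-x refl (inj₂ p) (inj₁ lt) = ⊥-elim (<ᴸ-irrefl (<ᴸ-trans lt (P< p)))
    after-x refl (inj₂ p) (inj₂ e)  = sym e

    Sorted : (ℕ → Ext k l) → Set
    Sorted c = ∀ n y z → c n ≡ just y → c (suc n) ≡ just z → y <ᴸ z ⊎ y ≡ z

    Letters : (ℕ → Ext k l) → Set
    Letters c = ∀ n y → c n ≡ just y → y ≡ x ⊎ P y

    constant-row : ∀ r → Sorted (nth r) → Letters (nth r) → (∀ y → nth r 0 ≡ just y → y ≡ x) → r ≡ replicate (length r) x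
    constant-row []      w le h = refl
    constant-row (y ∷ r) w le h with refl ← h y refl = cong (x ∷_) (constant-row r (λ n → w (suc n)) (λ n → le (suc n))
      (λ z e → after-x refl (le 1 z e) (w 0 x z refl e)))

    split-row : ∀ r → Sorted (nth r) → Letters (nth r) →
                ∃ λ r′ → ∃ λ m → r ≡ r′ ++ replicate m x × (∀ n y → nth r′ n ≡ just y → P y)
    split-row []      w le = [] , 0 , refl , λ n y ()
    split-row (y ∷ r) w le with le 0 y refl
    ... | inj₁ refl = [] , suc (length r) , constant-row (x ∷ r) w le (λ z e → sym (just-injective e)) , λ n y ()
    ... | inj₂ p with split-row r (λ n → w (suc n)) (λ n → le (suc n))
    ...   | r′ , m , e , h = y ∷ r′ , m , cong (y ∷_) e , λ { zero z refl → p ; (suc n) → h n }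

    record Standing (F : Filling k l) : Set where
      constructor standing
      field
        nonempty : All (λ row → 0 < length row) F
        rows     : ∀ i → Sorted (cell F i)
        column   : Sorted (λ i → cell F i 0)
        letters  : ∀ i → Letters (cell F i)

    standing-tail : ∀ {r F} → Standing (r ∷ F) → Standing F
    standing-tail (standing (_ ∷ ne) w c le) = standing ne (λ i → w (suc i)) (λ i → c (suc i)) (λ i → le (suc i))

    first-cell : ∀ r → 0 < length r → ∃ λ y → nth {Letter k l} r 0 ≡ just y
    first-cell (y ∷ r) _ = y , refl

    all-new : ∀ F → Standing F → (∀ y → cell F 0 0 ≡ just y → y ≡ x) → Adjoin x [] F
    all-new []      _ h = []
    all-new (r ∷ F) s@(standing (ne ∷ _) w c le) h with first-cell r ne
    ... | y , e = subst (λ r → Adjoin x [] (r ∷ F)) (sym (constant-row r (w 0) (le 0) h))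
      (new (length r) (all-new F (standing-tail s) (λ z e′ → after-x (h y e) (le 1 0 z e′) (c 0 y z e e′))))

    -- Along a row the copies of `x` form a final segment. Once a row starts with `x`, so do all
    -- rows above it, by the first column; from there on everything is new and `F′` ends.
    split : ∀ F → Standing F → ∃ λ F′ → Adjoin x F′ F × Pos (shape F′) × (∀ i n y → cell F′ i n ≡ just y → P y)
    split [] s = [] , [] , [] , λ i n y ()
    split (r ∷ F) s@(standing (ne ∷ _) w c le) with split-row r (w 0) (le 0)
    ... | [] , m , e , h = [] , all-new (r ∷ F) s (first-x m e) , [] , λ i n y ()
      where
      first-x : ∀ m {r} → r ≡ replicate m x → ∀ y → nth r 0 ≡ just y → y ≡ x
      first-x (suc m) refl y e = sym (just-injective e)
    ... | r′@(_ ∷ _) , m , refl , h with split F (standing-tail s)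
    ...   | F′ , ad , p , h′ = r′ ∷ F′ , old r′ m ad , s≤s z≤n ∷ p , λ { zero → h ; (suc i) → h′ i }

  HCT-standing : ∀ {x : Letter k l} {P : Letter k l → Set} {F} (P< : ∀ {y} → P y → y <ᴸ x) → IsHCT F →
                 (∀ i n y → cell F i n ≡ just y → y ≡ x ⊎ P y) → Standing {P = P} P< F
  HCT-standing P< t le = standing composition
    (λ i n y z e e′ → Sum.map₂ proj₁ (rows i n y z e e′))
    (λ i y z e e′ → Sum.map₂ proj₁ (firstColumn i y z e e′)) le
    where open IsHCT t

  Descending : ∀ {n} → Vec (Letter k l) n → Set
  Descending xs = ∀ {i j} → i Fin.< j → lookup xs j <ᴸ lookup xs i

  Listed : ∀ {n} → Vec (Letter k l) n → Letter k l → Set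
  Listed xs y = ∃ λ i → lookup xs i ≡ y

  desc-tail : ∀ {n x} {xs : Vec (Letter k l) n} → Descending (x ∷ xs) → Descending xs
  desc-tail d lt = d (s≤s lt)

  listed-below : ∀ {n x} {xs : Vec (Letter k l) n} → Descending (x ∷ xs) → ∀ {y} → Listed xs y → y <ᴸ x
  listed-below d (i , refl) = d {Fin.zero} {Fin.suc i} (s≤s z≤n)

  data Tableau : ∀ {n} → Vec (Letter k l) n → Filling k l → Chain n → Set where
    []   : Tableau [] [] []
    cons : ∀ {n x F′ F} {xs : Vec (Letter k l) n} {ps} → Tableau xs F′ ps → Below x F′ → Adjoin x F′ F →
           Extends (tag x) (shape F′) (shape F) → Tableau (x ∷ xs) F (heights (shape F) ∷ ps)

  []-HCT : IsHCT {k} {l} []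
  []-HCT = record { composition = [] ; rows = λ i n x y () ; firstColumn = λ i x y ()
                  ; tripleA = λ i j n _ () ; tripleB = λ i j n _ () }

  tableau-HCT : ∀ {n F ps} {xs : Vec (Letter k l) n} → Tableau xs F ps → IsHCT F
  tableau-HCT []              = []-HCT
  tableau-HCT (cons t b ad e) = adjoin-HCT ad b (tableau-HCT t) e

  tableau-pos : ∀ {n F ps} {xs : Vec (Letter k l) n} → Tableau xs F ps → Pos (shape F)
  tableau-pos []             = []
  tableau-pos (cons _ _ _ e) = Extends.pos e

  -- The largest letter is split off; `restrict-HCT` keeps the remainder a tableau for the
  -- recursion, and `restrict-extends` shows the removed cells to be an admissible addition.
  HCT-tableau : ∀ {n F} (xs : Vec (Letter k l) n) → Descending xs → IsHCT F →
                (∀ i n y → cell F i n ≡ just y → Listed xs y) → ∃ λ ps → Tableau xs F ps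
  HCT-tableau {F = []}          []       d t le = [] , []
  HCT-tableau {F = [] ∷ F}      []       d t le with () ∷ _ ← IsHCT.composition t
  HCT-tableau {F = (y ∷ r) ∷ F} []       d t le with () , _ ← le 0 0 y refl
  HCT-tableau {F = F}           (x ∷ xs) d t le
    with split {P = Listed xs} (listed-below d) F (HCT-standing {P = Listed xs} (listed-below d) t λ i n y e → first-or-later (le i n y e))
    where
    first-or-later : ∀ {y} → Listed (x ∷ xs) y → y ≡ x ⊎ Listed xs y
    first-or-later (Fin.zero , e)  = inj₁ (sym e)
    first-or-later (Fin.suc i , e) = inj₂ (i , e)
  ... | F′ , ad , p , h with HCT-tableau xs (desc-tail d) (restrict-HCT ad b t p) h
    where
    b : Below x F′
    b i n y e = listed-below d (h i n y e)
  ... | ps , t′ = _ , cons t′ b ad (restrict-extends ad b t p)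
    where
    b : Below x F′
    b i n y e = listed-below d (h i n y e)

  tableau-top : ∀ {n F ps} {xs : Vec (Letter k l) n} → Tableau xs F ps → top ps ≡ heights (shape F)
  tableau-top []             = refl
  tableau-top (cons _ _ _ _) = refl

  tableau-strips : ∀ {n F ps} {xs : Vec (Letter k l) n} → Tableau xs F ps → Strips (Vec.map tag xs) ps
  tableau-strips [] = []
  tableau-strips (cons {x = x} {F = F} t b ad e) = cons (heights-part (shape F))
    (subst (λ p → Step (tag x) p _) (sym (tableau-top t)) (extends-step e)) (tableau-strips t)

  tableau-listed : ∀ {n F ps} {xs : Vec (Letter k l) n} → Tableau xs F ps → ∀ i n y → cell F i n ≡ just y → Listed xs y
  tableau-listed [] i n y ()
  tableau-listed (cons t b ad e) i n y c with view ad i n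
  ... | kept c′ d _ _ with tableau-listed t i n y (trans c′ (trans (sym d) c))
  ...   | j , q = Fin.suc j , q
  tableau-listed (cons t b ad e) i n y c | added _ d _ _   = Fin.zero , just-injective (trans (sym d) c)
  tableau-listed (cons t b ad e) i n y c | outside _ d _ _ with () ← trans (sym d) c

  -- Each partition of the chain is lifted to the composition that extends the shape built so far,
  -- and the added cells receive the letter.
  strips-tableau : ∀ {n ps} (xs : Vec (Letter k l) n) → Descending xs → Strips (Vec.map tag xs) ps →
                   ∃ λ F → Tableau xs F ps
  strips-tableau []       d []            = [] , []
  strips-tableau (x ∷ xs) d (cons {p = p} pp s c) with strips-tableau xs (desc-tail d) c
  ... | F′ , t with extends-exists (tableau-pos t) pp (tag x) (subst (λ q → Step (tag x) q p) (tableau-top t) s)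
  ...   | α , e , refl with adjoin-exists x F′ {α} (tableau-pos t) (Extends.below e)
  ...     | F , ad , refl = F , cons t (λ i n y c → listed-below d (tableau-listed t i n y c)) ad e

  -- The chain fixes the column heights after each letter; `extends-unique` turns them into a shape
  -- and `adjoin-unique` into a filling.
  tableau-unique : ∀ {n F F′ ps} {xs : Vec (Letter k l) n} → Tableau xs F ps → Tableau xs F′ ps → F ≡ F′
  tableau-unique t t′ = go t t′ refl
    where
    go : ∀ {n F F′ ps ps′} {xs : Vec (Letter k l) n} → Tableau xs F ps → Tableau xs F′ ps′ → ps ≡ ps′ → F ≡ F′
    go []              []                  _ = refl
    go (cons t b ad e) (cons t′ b′ ad′ e′) q with go t t′ (Vec-tail q)
      where
      Vec-tail : ∀ {n p p′} {ps ps′ : Chain n} → p ∷ ps ≡ p′ ∷ ps′ → ps ≡ ps′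
      Vec-tail refl = refl
    ... | refl = adjoin-unique (Extends.pos e) ad ad′ (extends-unique e e′ (cong top q))

  chain-unique : ∀ {n F ps ps′} {xs : Vec (Letter k l) n} → Tableau xs F ps → Tableau xs F ps′ → ps ≡ ps′
  chain-unique []              []                  = refl
  chain-unique (cons t b ad e) (cons t′ b′ ad′ e′)
    with refl ← restrict-unique (tableau-pos t) (tableau-pos t′) b b′ ad ad′ = cong (_ ∷_) (chain-unique t t′)

  -- The copies of a letter are the cells it adds, and their number is the increase in size, which
  -- `heights` preserves. Larger letters do not change the count.
  tableau-count : ∀ {n F ps ws} {xs : Vec (Letter k l) n} → Descending xs → Tableau xs F ps → Weights ps ws →
                  ∀ i → count (lookup xs i) F ≡ lookup ws i
  tableau-count d (cons {F′ = F′} {F} {ps = ps} t b ad e) (cons {w = w} eq ws) Fin.zero =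
    +-cancelˡ-≡ (sum (shape F′)) _ _ (begin
      sum (shape F′) + count _ F ≡⟨ count-added b ad ⟨
      sum (shape F)              ≡⟨ sum-heights (shape F) ⟨
      sum (heights (shape F))    ≡⟨ eq ⟩
      sum (top ps) + w           ≡⟨ cong (λ p → sum p + w) (tableau-top t) ⟩
      sum (heights (shape F′)) + w ≡⟨ cong (_+ w) (sum-heights (shape F′)) ⟩
      sum (shape F′) + w ∎)
    where open ≡-Reasoning
  tableau-count {xs = x ∷ xs} d (cons t b ad e) (cons eq ws) (Fin.suc i) =
    trans (count-other (λ q → <ᴸ-irrefl (subst (_<ᴸ x) q (listed-below d (i , refl)))) ad)
          (tableau-count (desc-tail d) t ws i)

-- From matrices to growth diagrams

lookup-ext : ∀ {A : Set} {n} {v w : Vec A n} → (∀ i → lookup v i ≡ lookup w i) → v ≡ w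
lookup-ext {v = v} {w} e = trans (sym (tabulate∘lookup v)) (trans (tabulate-cong e) (tabulate∘lookup w))

opposite-anti : ∀ {n} {i j : Fin n} → i Fin.< j → opposite j Fin.< opposite i
opposite-anti {n} {i} {j} lt rewrite Fin.opposite-prop i | Fin.opposite-prop j =
  ∸-monoʳ-< (s≤s lt) (Fin.toℕ<n j)

splitAt-mono : ∀ k {l} {i j : Fin (k + l)} → i Fin.< j → splitAt k i <ᴸ splitAt k j
splitAt-mono zero    lt = p<p lt
splitAt-mono (suc k) {i = Fin.zero}  {Fin.suc j} lt with splitAt k j
... | inj₁ _ = u<u (s≤s z≤n)
... | inj₂ _ = u<p
splitAt-mono (suc k) {i = Fin.suc i} {Fin.suc j} (s≤s lt) with splitAt k i | splitAt k j | splitAt-mono k {i = i} {j} lt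
... | inj₁ _ | inj₁ _ | u<u p = u<u (s≤s p)
... | inj₁ _ | inj₂ _ | _     = u<p
... | inj₂ _ | inj₂ _ | p<p p = p<p p

alphabet : ∀ k l → Vec (Letter k l) (k + l)
alphabet k l = tabulate (splitAt k ∘ opposite)

position : ∀ k l → Letter k l → Fin (k + l)
position k l c = opposite (join k l c)

lookup-position : ∀ k l c → lookup (alphabet k l) (position k l c) ≡ c
lookup-position k l c = trans (lookup∘tabulate _ (position k l c))
  (trans (cong (splitAt k) (Fin.opposite-involutive (join k l c))) (Fin.splitAt-join k l c))

alphabet-descending : ∀ k l → Descending (alphabet k l)
alphabet-descending k l {i} {j} lt
  rewrite lookup∘tabulate (splitAt k {l} ∘ opposite) i | lookup∘tabulate (splitAt k {l} ∘ opposite) j =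
  splitAt-mono k (opposite-anti lt)

rev : ∀ {A : Set} {n} → Vec A n → Vec A n
rev v = tabulate (lookup v ∘ opposite)

sum-lookup : ∀ {n} (v : Vec ℕ n) → Sumᶠ.sum (lookup v) ≡ Vec.sum v
sum-lookup []      = refl
sum-lookup (x ∷ v) = cong (x +_) (sum-lookup v)

sum-rev : ∀ {n} (v : Vec ℕ n) → Vec.sum (rev v) ≡ Vec.sum v
sum-rev {n} v = begin
  Vec.sum (rev v)              ≡⟨ sum-lookup (rev v) ⟨
  Sumᶠ.sum (lookup (rev v))    ≡⟨ Sumᶠ.sum-cong-≗ (lookup∘tabulate (lookup v ∘ opposite)) ⟩
  Sumᶠ.sum (lookup v ∘ opposite) ≡⟨ Sumᶠ.sum-permute (lookup v) Perm.reverse ⟨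
  Sumᶠ.sum (lookup v)          ≡⟨ sum-lookup v ⟩
  Vec.sum v                    ∎
  where open ≡-Reasoning

sum-toList : ∀ {n} (v : Vec ℕ n) → sum (Vec.toList v) ≡ Vec.sum v
sum-toList []      = refl
sum-toList (x ∷ v) = cong (x +_) (sum-toList v)

-- Chains list the largest letter first, so growth diagrams are fed the matrix rotated by 180 degrees.
rotate : ∀ {m n} → Vec (Vec ℕ n) m → Vec (Vec ℕ n) m
rotate M = rev (Vec.map rev M)

lookup-rotate : ∀ {m n} (M : Vec (Vec ℕ n) m) i → lookup (rotate M) i ≡ rev (lookup M (opposite i))
lookup-rotate M i = trans (lookup∘tabulate _ i) (lookup-map (opposite i) rev M)

rev-involutive : ∀ {A : Set} {n} (v : Vec A n) → rev (rev v) ≡ v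
rev-involutive v = lookup-ext λ i → trans (lookup∘tabulate _ i)
  (trans (lookup∘tabulate _ (opposite i)) (cong (lookup v) (Fin.opposite-involutive i)))

rotate-involutive : ∀ {m n} (M : Vec (Vec ℕ n) m) → rotate (rotate M) ≡ M
rotate-involutive M = lookup-ext λ i → trans (lookup-rotate (rotate M) i)
  (trans (cong rev (lookup-rotate M (opposite i)))
    (trans (rev-involutive _) (cong (lookup M) (Fin.opposite-involutive i))))

lookup-columnSums : ∀ {n k} (M : Vec (Vec ℕ n) k) j → lookup (columnSums M) j ≡ Vec.sum (Vec.map (λ row → lookup row j) M)
lookup-columnSums []       j = lookup-replicate j 0
lookup-columnSums (ms ∷ M) j = trans (lookup-zipWith _+_ j ms (columnSums M)) (cong (lookup ms j +_) (lookup-columnSums M j))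

bounded-from : ∀ {n τ} {ts : Vec Tag n} {ms} → (∀ j → Bound (lookup ts j) τ (lookup ms j)) → Bounded ts τ ms
bounded-from {ts = []}     {[]}     h = []
bounded-from {ts = t ∷ ts} {m ∷ ms} h = cons (h Fin.zero) (bounded-from (h ∘ Fin.suc))

bounded-at : ∀ {n τ} {ts : Vec Tag n} {ms} → Bounded ts τ ms → ∀ j → Bound (lookup ts j) τ (lookup ms j)
bounded-at (cons b bs) Fin.zero    = b
bounded-at (cons b bs) (Fin.suc j) = bounded-at bs j

allBounded-from : ∀ {n k} {ts : Vec Tag n} {us : Vec Tag k} {M} →
  (∀ i → Bounded ts (lookup us i) (lookup M i)) → AllBounded ts us M
allBounded-from {us = []}     {[]}    h = []
allBounded-from {us = u ∷ us} {m ∷ M} h = cons (h Fin.zero) (allBounded-from (h ∘ Fin.suc))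

allBounded-at : ∀ {n k} {ts : Vec Tag n} {us : Vec Tag k} {M} → AllBounded ts us M →
  ∀ i → Bounded ts (lookup us i) (lookup M i)
allBounded-at (cons b bs) Fin.zero    = b
allBounded-at (cons b bs) (Fin.suc i) = allBounded-at bs i

mixed-bound : ∀ {k₁ l₁ k₂ l₂} (r : Letter k₂ l₂) (c : Letter k₁ l₁) {m} → (Mixed r c → m ≤ 1) → Bound (tag c) (tag r) m
mixed-bound (inj₁ _) (inj₁ _) h = tt
mixed-bound (inj₁ _) (inj₂ _) h = h up
mixed-bound (inj₂ _) (inj₁ _) h = h pu
mixed-bound (inj₂ _) (inj₂ _) h = tt

bound-mixed : ∀ {k₁ l₁ k₂ l₂} {r : Letter k₂ l₂} {c : Letter k₁ l₁} {m} → Mixed r c → Bound (tag c) (tag r) m → m ≤ 1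
bound-mixed up b = b
bound-mixed pu b = b

-- Bijections from relations

module _ {A B : Set} {P : A → Set} {Q : B → Set} (R : A → B → Set)
  (forward : ∀ a → P a → ∃ λ b → Q b × R a b) (backward : ∀ b → Q b → ∃ λ a → P a × R a b)
  (functional : ∀ {a b b′} → R a b → R a b′ → b ≡ b′) (injective : ∀ {a a′ b} → R a b → R a′ b → a ≡ a′) where

  private
    to : Σ A P → Σ B Q
    to (a , p) = proj₁ (forward a p) , proj₁ (proj₂ (forward a p))

    from : Σ B Q → Σ A P
    from (b , q) = proj₁ (backward b q) , proj₁ (proj₂ (backward b q))

    to-R : ∀ x → R (proj₁ x) (proj₁ (to x))
    to-R (a , p) = proj₂ (proj₂ (forward a p))

    from-R : ∀ y → R (proj₁ (from y)) (proj₁ y)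
    from-R (b , q) = proj₂ (proj₂ (backward b q))

  -- Both maps follow the relation, so uniqueness on either side makes them mutually inverse.
  -- Keeping the relation in the result gives access to the weights.
  relation-inverse : Σ (Inverse (subSetoid A P) (subSetoid B Q)) λ φ → ∀ x → R (proj₁ x) (proj₁ (Inverse.to φ x))
  relation-inverse = record
    { to = to ; from = from
    ; to-cong = λ { {x} {y} refl → functional (to-R x) (to-R y) }
    ; from-cong = λ { {x} {y} refl → injective (from-R x) (from-R y) }
    ; inverse = (λ { {x} {y} refl → functional (to-R y) (from-R x) })
              , (λ { {x} {y} refl → injective (from-R y) (to-R x) })
    } , to-R

-- The correspondence and its weights

module _ (k₁ l₁ k₂ l₂ : ℕ) where

  private
    xs = alphabet k₁ l₁
    ys = alphabet k₂ l₂

  Corresponds : Matrix k₁ l₁ k₂ l₂ → Filling k₁ l₁ × Filling k₂ l₂ → Set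
  Corresponds M (P , Q) = ∃ λ ps → ∃ λ qs →
    Growth (Vec.map tag xs) (Vec.map tag ys) (rotate M) ps qs × Tableau xs P ps × Tableau ys Q qs

  lookup-tag : ∀ k l i → lookup (Vec.map tag (alphabet k l)) i ≡ tag (splitAt k {l} (opposite i))
  lookup-tag k l i = trans (lookup-map i tag (alphabet k l)) (cong tag (lookup∘tabulate _ i))

  InM-bounded : ∀ M → InM k₁ l₁ k₂ l₂ M → AllBounded (Vec.map tag xs) (Vec.map tag ys) (rotate M)
  InM-bounded M h = allBounded-from λ i → bounded-from λ j →
    subst₂ (λ σ τ → Bound σ τ (lookup (lookup (rotate M) i) j)) (sym (lookup-tag k₁ l₁ j)) (sym (lookup-tag k₂ l₂ i))
      (mixed-bound (splitAt k₂ (opposite i)) (splitAt k₁ (opposite j)) (λ mx → subst (_≤ 1) (entry-rotate i j) (h _ _ mx)))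
    where
    entry-rotate : ∀ i j → entry {k₁} {l₁} {k₂} {l₂} M (splitAt k₂ (opposite i)) (splitAt k₁ (opposite j)) ≡
                           lookup (lookup (rotate M) i) j
    entry-rotate i j rewrite lookup-rotate M i | lookup∘tabulate (lookup (lookup M (opposite i)) ∘ opposite) j
      | Fin.join-splitAt k₂ l₂ (opposite i) | Fin.join-splitAt k₁ l₁ (opposite j) = refl

  bounded-InM : ∀ M → AllBounded (Vec.map tag xs) (Vec.map tag ys) M → InM k₁ l₁ k₂ l₂ (rotate M)
  bounded-InM M b r c mx = bound-mixed mx (subst₂
    (λ σ τ → Bound σ τ (entry {k₁} {l₁} {k₂} {l₂} (rotate M) r c)) (tag-at k₁ l₁ c) (tag-at k₂ l₂ r)
    (subst (Bound _ _) (sym entry-rotate) (bounded-at (allBounded-at b (position k₂ l₂ r)) (position k₁ l₁ c))))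
    where
    tag-at : ∀ k l c → lookup (Vec.map tag (alphabet k l)) (position k l c) ≡ tag c
    tag-at k l c = trans (lookup-map (position k l c) tag (alphabet k l)) (cong tag (lookup-position k l c))
    entry-rotate : entry {k₁} {l₁} {k₂} {l₂} (rotate M) r c ≡ lookup (lookup M (position k₂ l₂ r)) (position k₁ l₁ c)
    entry-rotate = trans (cong (λ v → lookup v (join k₁ l₁ c)) (lookup-rotate M (join k₂ l₂ r)))
                         (lookup∘tabulate _ (join k₁ l₁ c))

  forward : ∀ M → InM k₁ l₁ k₂ l₂ M → ∃ λ PQ → IsHCTPair PQ × Corresponds M PQ
  forward M h with growth-forward (Vec.map tag xs) (InM-bounded M h)
  ... | ps , qs , c , d , g
    with strips-tableau xs (alphabet-descending k₁ l₁) c | strips-tableau ys (alphabet-descending k₂ l₂) d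
  ...   | P , t | Q , u = (P , Q) ,
    (tableau-HCT t , tableau-HCT u , sortDesc-≡ (tableau-pos t) (tableau-pos u)
      (trans (sym (tableau-top t)) (trans (growth-top g) (tableau-top u)))) ,
    ps , qs , g , t , u

  listed : ∀ k l {F : Filling k l} i n y → cell F i n ≡ just y → Listed (alphabet k l) y
  listed k l i n y _ = position k l y , lookup-position k l y

  backward : ∀ PQ → IsHCTPair PQ → ∃ λ M → InM k₁ l₁ k₂ l₂ M × Corresponds M PQ
  backward (P , Q) (hP , hQ , e)
    with HCT-tableau xs (alphabet-descending k₁ l₁) hP (listed k₁ l₁ {P})
       | HCT-tableau ys (alphabet-descending k₂ l₂) hQ (listed k₂ l₂ {Q})
  ... | ps , t | qs , u with growth-backward (tableau-strips t) (tableau-strips u)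
                              (trans (tableau-top t) (trans (heights-≡ {shape P} {shape Q} e) (sym (tableau-top u))))
  ...   | M , g = rotate M , bounded-InM M (growth-bounded g) , ps , qs ,
    subst (λ M → Growth _ _ M ps qs) (sym (rotate-involutive M)) g , t , u

  functional : ∀ {M PQ PQ′} → Corresponds M PQ → Corresponds M PQ′ → PQ ≡ PQ′
  functional (_ , _ , g , t , u) (_ , _ , g′ , t′ , u′) with refl , refl ← growth-forward-unique g g′ =
    cong₂ _,_ (tableau-unique t t′) (tableau-unique u u′)

  injective : ∀ M M′ {PQ} → Corresponds M PQ → Corresponds M′ PQ → M ≡ M′
  injective M M′ (_ , _ , g , t , u) (_ , _ , g′ , t′ , u′)
    with refl ← chain-unique t t′ | refl ← chain-unique u u′ =
    trans (sym (rotate-involutive M)) (trans (cong rotate (growth-backward-unique g g′)) (rotate-involutive M′))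

  weights : ∀ M {P Q} → Corresponds M (P , Q) →
    ((c : Letter k₁ l₁) → count c P ≡ colSum k₁ l₁ k₂ l₂ M c) × ((r : Letter k₂ l₂) → count r Q ≡ rowSum k₁ l₁ k₂ l₂ M r)
  weights M {P} {Q} (ps , qs , g , t , u) = columns , rows
    where
    open ≡-Reasoning
    columns : ∀ c → count c P ≡ colSum k₁ l₁ k₂ l₂ M c
    columns c = begin
      count c P
        ≡⟨ cong (λ c → count c P) (lookup-position k₁ l₁ c) ⟨
      count (lookup xs j) P
        ≡⟨ tableau-count (alphabet-descending k₁ l₁) t (proj₁ (growth-weights g)) j ⟩
      lookup (columnSums (rotate M)) j
        ≡⟨ lookup-columnSums (rotate M) j ⟩
      Vec.sum (Vec.map (λ row → lookup row j) (rotate M))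
        -- Column `j` of the rotated matrix is column `c` of `M` read backwards.
        ≡⟨ cong Vec.sum (lookup-ext {v = Vec.map (λ row → lookup row j) (rotate M)} {w = rev entries} column) ⟩
      Vec.sum (rev entries)
        ≡⟨ sum-rev entries ⟩
      Vec.sum entries
        ≡⟨ sum-toList entries ⟨
      colSum k₁ l₁ k₂ l₂ M c ∎
      where
      j = position k₁ l₁ c
      entries = Vec.map (λ row → lookup row (join k₁ l₁ c)) M
      column : ∀ i → lookup (Vec.map (λ row → lookup row j) (rotate M)) i ≡
                     lookup (rev entries) i
      column i = begin
        lookup (Vec.map (λ row → lookup row j) (rotate M)) i ≡⟨ lookup-map i _ (rotate M) ⟩
        lookup (lookup (rotate M) i) j                       ≡⟨ cong (λ v → lookup v j) (lookup-rotate M i) ⟩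
        lookup (rev (lookup M (opposite i))) j               ≡⟨ lookup∘tabulate _ j ⟩
        lookup (lookup M (opposite i)) (opposite j)          ≡⟨ cong (lookup (lookup M (opposite i))) (Fin.opposite-involutive (join k₁ l₁ c)) ⟩
        lookup (lookup M (opposite i)) (join k₁ l₁ c)        ≡⟨ lookup-map (opposite i) _ M ⟨
        lookup entries (opposite i)                          ≡⟨ lookup∘tabulate _ i ⟨
        lookup (rev entries) i ∎
    rows : ∀ r → count r Q ≡ rowSum k₁ l₁ k₂ l₂ M r
    rows r = begin
      count r Q
        ≡⟨ cong (λ r → count r Q) (lookup-position k₂ l₂ r) ⟨
      count (lookup ys i) Q
        ≡⟨ tableau-count (alphabet-descending k₂ l₂) u (proj₂ (growth-weights g)) i ⟩
      lookup (Vec.map Vec.sum (rotate M)) i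
        ≡⟨ lookup-map i Vec.sum (rotate M) ⟩
      Vec.sum (lookup (rotate M) i)
        ≡⟨ cong Vec.sum (lookup-rotate M i) ⟩
      Vec.sum (rev (lookup M (opposite i)))
        ≡⟨ sum-rev (lookup M (opposite i)) ⟩
      Vec.sum (lookup M (opposite i))
        ≡⟨ cong (λ i → Vec.sum (lookup M i)) (Fin.opposite-involutive (join k₂ l₂ r)) ⟩
      Vec.sum (lookup M (join k₂ l₂ r))
        ≡⟨ sum-toList (lookup M (join k₂ l₂ r)) ⟨
      rowSum k₁ l₁ k₂ l₂ M r ∎
      where
      i = position k₂ l₂ r

theorem6p3 : (k₁ l₁ k₂ l₂ : ℕ) →
    Σ (Inverse (𝓜 k₁ l₁ k₂ l₂) (HCTPairs k₁ l₁ k₂ l₂)) λ φ →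
    ∀ M →
    ((c : Letter k₁ l₁) →
    count c (proj₁ (proj₁ (Inverse.to φ M))) ≡ colSum k₁ l₁ k₂ l₂ (proj₁ M) c)
    ×
    ((r : Letter k₂ l₂) →
    count r (proj₂ (proj₁ (Inverse.to φ M))) ≡ rowSum k₁ l₁ k₂ l₂ (proj₁ M) r)
theorem6p3 k₁ l₁ k₂ l₂ with relation-inverse (Corresponds k₁ l₁ k₂ l₂) (forward k₁ l₁ k₂ l₂) (backward k₁ l₁ k₂ l₂)
                              (λ {M} → functional k₁ l₁ k₂ l₂ {M}) (λ {M} {M′} → injective k₁ l₁ k₂ l₂ M M′)
... | φ , corresponds = φ , λ M → weights k₁ l₁ k₂ l₂ (proj₁ M) (corresponds M)
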